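{- Let $G$ be a finite digraph, and let $a,b\in V(G)$ (possibly equal). Put $A=N^+(a)\setminus\{b\}$ and $B=N^-(b)\setminus\{a\}$. Let $H=\operatorname{Ind}(A\setminus B,B\setminus A)$ be the induced digraph from $A\setminus B$ to $B\setminus A$, let $t$ be the number of its connected components (regarding $H$ as an undirected graph), and write these components as $H_1,\dots,H_t$. For each $k\in\{1,\dots,t\}$ let $S_k$ be the set of edges of $G$ that either start in $V(H_k)\setminus B$ and end in $(N^+(a)\cup\{a\})\cap N^-(b)$, or start in $N^+(a)\cap(N^-(b)\cup\{b\})$ and end in $V(H_k)\setminus A$. Then $$\dim\Omega_3^{(a,b)}(G)=\bigl(|E(H)|-|V(H)|+t\bigr)+\Bigl|E\bigl(N^+(a)\cap(N^-(b)\cup\{b\}),\,(N^+(a)\cup\{a\})\cap N^-(b)\bigr)\Bigr|+\sum_{k=1}^t\max\{0,|S_k|-1\}.$$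
   Context: A digraph is a pair $G=(V,E)$ with $E\subset (V\times V)\setminus\mathrm{diag}$; write $i\to j$ if $(i,j)\in E$. $N^+(v)=\{w: v\to w\}$ and $N^-(v)=\{w: w\to v\}$. For $X,Y\subseteq V$, $E(X,Y)=\{(u,v)\in E: u\in X, v\in Y\}$. For disjoint $X,Y\subseteq V$, $\operatorname{Ind}(X,Y)$ is the digraph with vertex set $X\cup Y$ and edge set $E(X,Y)$ (isolated vertices are kept and count as components). Fix a field $\mathbb{K}$. An elementary $p$-path is a sequence $i_0,\dots,i_p$ of vertices (repetitions allowed), written $e_{i_0\dots i_p}$; $\Lambda_p$ is the $\mathbb{K}$-vector space with basis all elementary $p$-paths. The boundary is $\partial e_{i_0\dots i_p}=\sum_{q=0}^p(-1)^q e_{i_0\dots\widehat{i_q}\dots i_p}$. An elementary path is irregular if $i_k=i_{k+1}$ for some $k$; $\mathcal{I}_p$ is the span of irregular ones, $\mathcal{R}_p=\Lambda_p/\mathcal{I}_p$, and $\partial$ descends to $\mathcal{R}_p\to\mathcal{R}_{p-1}$. An elementary path is allowed if $i_k\to i_{k+1}$ for all $k$; $\mathcal{A}_p(G)\subset\mathcal{R}_p$ is the span of allowed elementary $p$-paths, and $\Omega_p(G)=\{u\in\mathcal{A}_p(G):\partial u\in\mathcal{A}_{p-1}(G)\}$. $\Omega_3^{(a,b)}(G)$ is the subspace of those $\omega\in\Omega_3(G)$ all of whose elementary terms with nonzero coefficient start at $a$ and end at $b$. -}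

module Defs where

open import Level using (Level; _⊔_; 0ℓ) renaming (suc to lsuc)
open import Algebra.Bundles using (CommutativeRing)
open import Algebra.Apartness.Bundles using (HeytingField; HeytingCommutativeRing)
import Algebra.Properties.Semiring.Exp as Exp
import Algebra.Properties.Semiring.Sum as Sum
open import Data.Bool.Base using (if_then_else_)
open import Data.Fin.Base using (Fin; suc; inject₁; toℕ)
import Data.Fin.Properties as Fin
open import Data.Fin.Subset using (Subset; _∈_; _∪_; _∩_; _─_; ⁅_⁆)
open import Data.Fin.Subset.Properties using (_∈?_)
open import Data.List.Base using (List; allFin; cartesianProduct; filter)
import Data.List.Membership.Propositional as List
open import Data.Nat.Base using (ℕ; zero; suc)
open import Data.Product.Base using (_×_; _,_; proj₁; proj₂; uncurry; ∃; ∃-syntax)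
open import Data.Vec.Base using (Vec; []; _∷_; head; last; lookup; removeAt; tabulate)
open import Data.Vec.Functional using (Vector)
open import Data.Vec.Properties using (≡-dec)
open import Function.Base using (_∘_)
open import Function.Bundles using (_⇔_)
open import Function.Definitions using (Injective)
open import Relation.Binary.Core using (Rel)
open import Relation.Binary.Construct.Closure.Equivalence using (EqClosure)
open import Relation.Binary.Definitions using (Decidable)
open import Relation.Binary.PropositionalEquality.Core using (_≡_)
open import Relation.Nullary.Decidable using (does; _×-dec_; _⊎-dec_)
open import Relation.Nullary.Negation using (¬_)
open import Relation.Unary using (Pred)

------------------------------------------------------------------------
-- Digraphs

record Digraph (n : ℕ) (ℓ : Level) : Set (lsuc ℓ) where
  infix 4 _⟶_ _⟶?_
  field
    _⟶_      : Rel (Fin n) ℓ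
    _⟶?_     : Decidable _⟶_
    loopless : ∀ v → ¬ (v ⟶ v)

  N⁺ : Fin n → Subset n
  N⁺ v = tabulate λ w → does (v ⟶? w)

  N⁻ : Fin n → Subset n
  N⁻ v = tabulate λ w → does (w ⟶? v)

  -- Sets of edges are duplicate-free lists, so `length` is cardinality.
  edges : List (Fin n × Fin n)
  edges = filter (uncurry _⟶?_) (cartesianProduct (allFin n) (allFin n))

  E : Subset n → Subset n → List (Fin n × Fin n)
  E X Y = filter (λ (u , v) → u ∈? X ×-dec v ∈? Y) edges

-- Digraphs on a subset of the ambient vertex set Fin n.
record PartialDigraph (n : ℕ) : Set where
  field
    vertexSet : Subset n
    edgeList  : List (Fin n × Fin n)

module _ {n ℓ} (G : Digraph n ℓ) where
  open Digraph G

  Ind : Subset n → Subset n → PartialDigraph n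
  Ind X Y = record { vertexSet = X ∪ Y ; edgeList = E X Y }

  -- The sets A, B and S_k; S takes the vertex set C of the component H_k.
  A-set B-set : (a b : Fin n) → Subset n
  A-set a b = N⁺ a ─ ⁅ b ⁆
  B-set a b = N⁻ b ─ ⁅ a ⁆

  S : (a b : Fin n) → Subset n → List (Fin n × Fin n)
  S a b C = filter
    (λ (u , v) →
      (u ∈? (C ─ B-set a b) ×-dec v ∈? ((N⁺ a ∪ ⁅ a ⁆) ∩ N⁻ b))
      ⊎-dec
      (u ∈? (N⁺ a ∩ (N⁻ b ∪ ⁅ b ⁆)) ×-dec v ∈? (C ─ A-set a b)))
    edges

-- Connected components of the underlying undirected graph, as vertex sets.
module _ {n} (H : PartialDigraph n) where
  open PartialDigraph H

  Connected : Rel (Fin n) 0ℓ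
  Connected = EqClosure λ u v → (u , v) List.∈ edgeList

  IsComponent : Pred (Subset n) 0ℓ
  IsComponent C =
    ∃[ v ] v ∈ vertexSet × (∀ w → w ∈ C ⇔ (w ∈ vertexSet × Connected v w))

  -- Each component is listed exactly once.
  record ListsComponents {t : ℕ} (Hs : Fin t → Subset n) : Set where
    field
      isComponent : ∀ k → IsComponent (Hs k)
      injective   : Injective _≡_ _≡_ Hs
      exhaustive  : ∀ C → IsComponent C → ∃[ k ] Hs k ≡ C

------------------------------------------------------------------------
-- Regular paths over a field

-- Elementary p-paths.
Path : ℕ → ℕ → Set
Path n p = Vec (Fin n) (suc p)

module _ {n p : ℕ} where

  Irregular : Pred (Path n p) 0ℓ
  Irregular i = ∃[ k ] lookup i (inject₁ k) ≡ lookup i (suc k)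

  Allowed : ∀ {ℓ} → Digraph n ℓ → Pred (Path n p) ℓ
  Allowed G i = ∀ k → lookup i (inject₁ k) ⟶ lookup i (suc k)
    where open Digraph G

module _ {c ℓ₁ ℓ₂} (K : HeytingField c ℓ₁ ℓ₂) (n : ℕ) where
  open HeytingField K
  open CommutativeRing
    (HeytingCommutativeRing.commutativeRing heytingCommutativeRing)
    using (semiring)
  open Exp semiring using (_^_)
  open Sum semiring using (sum)

  -- There are finitely many elementary p-paths, so the vector space on them
  -- consists of all coefficient functions.
  Λ : ℕ → Set c
  Λ p = Path n p → Carrier

  e : ∀ {p} → Path n p → Λ p
  e i j = if does (≡-dec Fin._≟_ i j) then 1# else 0#

  lincomb : ∀ {p m} → Vector Carrier m → Vector (Λ p) m → Λ p
  lincomb x v j = sum λ k → x k * v k j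

  sumAll : ∀ {m} → (Vec (Fin n) m → Carrier) → Carrier
  sumAll {zero}  f = f []
  sumAll {suc m} f = sum λ v → sumAll λ i → f (v ∷ i)

  -- The boundary of e i, and its linear extension.
  ∂e : ∀ {p} → Path n (suc p) → Λ p
  ∂e i = lincomb (λ q → (- 1#) ^ toℕ q) (λ q → e (removeAt i q))

  ∂ : ∀ {p} → Λ (suc p) → Λ p
  ∂ u j = sumAll λ i → u i * ∂e i j

  I : ∀ p → Pred (Λ p) (c ⊔ ℓ₁)
  I p u = ∃[ m ] ∃ λ (x : Vector Carrier m) → ∃ λ (i : Vector (Path n p) m) →
    (∀ k → Irregular (i k)) × (∀ j → u j ≈ lincomb x (e ∘ i) j)

  -- Equality in the quotient Λ p / I p. Elements of the quotient are
  -- represented by elements of Λ p; ∂ is compatible with this equality.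
  infix 4 _≈ᴿ_
  _≈ᴿ_ : ∀ {p} → Rel (Λ p) (c ⊔ ℓ₁)
  u ≈ᴿ v = I _ λ j → u j - v j

  -- P, a subspace of Λ p / I p, has a basis of d elements.
  HasDimension : ∀ {p ℓ} → Pred (Λ p) ℓ → ℕ → Set (c ⊔ ℓ₁ ⊔ ℓ)
  HasDimension {p} P d = ∃ λ (v : Vector (Λ p) d) →
    (∀ k → P (v k)) ×
    (∀ x → lincomb x v ≈ᴿ (λ _ → 0#) → ∀ k → x k ≈ 0#) ×
    (∀ u → P u → ∃[ x ] u ≈ᴿ lincomb x v)

  module _ {ℓ} (G : Digraph n ℓ) where

    𝒜 : ∀ p → Pred (Λ p) (c ⊔ ℓ₁ ⊔ ℓ)
    𝒜 p u = ∃[ m ] ∃ λ (x : Vector Carrier m) → ∃ λ (i : Vector (Path n p) m) →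
      (∀ k → Allowed G (i k)) × u ≈ᴿ lincomb x (e ∘ i)

    -- Ω (suc p) only: there is no condition on the boundary in degree 0.
    Ω⁺ : ∀ p → Pred (Λ (suc p)) (c ⊔ ℓ₁ ⊔ ℓ)
    Ω⁺ p u = 𝒜 (suc p) u × 𝒜 p (∂ u)

    -- Only coefficients at regular paths are well defined in the quotient.
    Ω₃ : (a b : Fin n) → Pred (Λ 3) (c ⊔ ℓ₁ ⊔ ℓ₂ ⊔ ℓ)
    Ω₃ a b u = Ω⁺ 2 u ×
      (∀ i → ¬ Irregular i → u i # 0# → head i ≡ a × last i ≡ b)

{-# OPTIONS --safe #-}
module Submission where

-- An element of Ω₃ from a to b is a combination of paths a i j b, that is, a weight
-- on the edges from N⁺(a) to N⁻(b). A summand e_{ajb} or e_{aib} of its boundary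
-- that is not allowed must cancel, which says exactly that the weight is a flow
-- conserved at each vertex of H; all other vertices put no condition and are
-- collapsed to one ground vertex. So the dimension is that of the cycle space of a
-- multigraph, edges − vertices + components, computed by contracting edges one at a
-- time. A component H_k stays separate from the ground vertex precisely if S_k is
-- empty.

open import Algebra.Apartness.Bundles using (HeytingCommutativeRing; HeytingField)
open import Algebra.Bundles using (CommutativeRing)
import Algebra.Properties.CommutativeMonoid.Sum as MonoidSum
import Algebra.Properties.Ring as RingProperties
import Algebra.Properties.Semiring.Exp as SemiringExp
import Algebra.Properties.Semiring.Sum as SemiringSum
open import Data.Bool.Base using (if_then_else_)
open import Data.Fin.Base using (Fin; zero; suc; inject₁; punchIn; punchOut)
open import Data.Fin.Properties using (_≟_; any?; all?; injective⇒≤; punchIn-punchOut; punchInᵢ≢i; punchOut-cong; punchOut-punchIn; suc-injective)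
open import Data.Fin.Subset using (Subset; _∈_; _∉_; _∪_; _∩_; _─_; ⁅_⁆; ∣_∣; inside; outside)
open import Data.Fin.Subset.Properties using (_∈?_; p─q⊆p; x∈p∩q⁺; x∈p∩q⁻; x∈p∪q⁺; x∈p∪q⁻; x∈p∧x∉q⇒x∈p─q; x∈⁅x⁆; x∈⁅y⁆⇒x≡y; ⊆-antisym)
open import Data.Integer.Base as ℤ using (+_; 0ℤ; 1ℤ)
import Data.Integer.Properties as ℤ
open import Data.Integer.Solver using (module +-*-Solver)
open import Data.List.Base as List using (List; allFin; cartesianProduct; cartesianProductWith; filter; length)
open import Data.List.Membership.Propositional using () renaming (_∈_ to _∈ˡ_)
open import Data.List.Membership.Propositional.Properties using (∈-allFin; ∈-cartesianProduct⁺; ∈-cartesianProductWith⁺; ∈-filter⁺; ∈-filter⁻; ∈-lookup)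
import Data.List.Relation.Unary.All as All
open import Data.List.Relation.Unary.AllPairs using ([]; _∷_)
open import Data.List.Relation.Unary.Any as Any using (here; there)
open import Data.List.Relation.Unary.Any.Properties using (lookup-index)
open import Data.List.Relation.Unary.Unique.Propositional using (Unique)
open import Data.List.Relation.Unary.Unique.Propositional.Properties using (allFin⁺; cartesianProduct⁺; cartesianProductWith⁺; filter⁺)
open import Data.Nat.Base as ℕ using (ℕ; zero; suc)
import Data.Nat.Properties as ℕ
open import Data.Product.Base using (_×_; _,_; proj₁; proj₂; ∃; ∃₂; ∃-syntax; uncurry)
open import Data.Sum.Base using (_⊎_; inj₁; inj₂; [_,_]′)
open import Data.Vec.Base as Vec using (Vec; []; _∷_; head; here; last; lookup; tabulate; there)
open import Data.Vec.Functional using (Vector; tail) renaming (_∷_ to _◂_)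
open import Data.Vec.Properties using (≡-dec; ∷-injective; []=⇒lookup; lookup⇒[]=; lookup∘tabulate)
open import Defs
open import Function.Base using (_∘_; id)
open import Function.Bundles using (Equivalence; mk⇔)
open import Function.Definitions using (Injective)
import Level
import Relation.Binary.Construct.Closure.Equivalence as EqClosure
open import Relation.Binary.PropositionalEquality as ≡ using (_≡_; _≢_)
open import Relation.Nullary.Decidable using (Dec; yes; no; does; dec-false; dec-true; _×-dec_; _⊎-dec_)
open import Relation.Nullary.Negation.Core using (¬_; contradiction)
open import Relation.Unary using (Decidable; Pred)
open Equivalence using (to; from)

-- Deleting `j` or `i` from a path a i j b gives - e_{ajb} and + e_{aib}, so the coefficient at
-- e_{ayb} is outflow minus inflow at y, and the constraints are rows of an incidence matrix. The
-- vertices a and b may also occur in the middle (i = b or j = a), but then the face e_{abb} or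
-- e_{aab} is irregular, hence zero in the quotient; so they belong to the ground.
--
-- Conservation at the ground vertex follows from conservation at all the others, because each edge
-- is counted once with each sign. The multigraph thus has |V(H)| + 1 vertices and 1 + #{k : S_k
-- empty} components, and the two ones cancel. The identity Σ |S_k| + #{k : S_k empty} = t + Σ
-- max(0, |S_k| - 1) then produces the last sum of the formula.
--
-- The components of H are given as a list, with connectedness a mere relation, whereas contraction
-- only yields a number of classes. The two counts are matched by a universal property that
-- determines the number of classes.

-- Coequalizers of finite multigraphs and edge contraction

-- The equivalence relation generated by s e ∼ t e has c classes. That two vertices
-- of one class are connected is expressed without walks: no map into a finite set
-- that is constant along the edges separates them.
record Coequalizer {k m} (s t : Fin k → Fin m) (c : ℕ) : Set where
  field
    quot      : Fin m → Fin c
    rep       : Fin c → Fin m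
    quot-rep  : ∀ y → quot (rep y) ≡ y
    equalizes : ∀ e → quot (s e) ≡ quot (t e)
    universal : ∀ {p} (f : Fin m → Fin p) → (∀ e → f (s e) ≡ f (t e)) →
                ∀ x → f (rep (quot x)) ≡ f x

module _ {k m} {s t : Fin k → Fin m} where
  open Coequalizer

  -- `quot P` is itself constant along the edges, so `universal Q` applies to it: the `Q`-class of a
  -- representative determines its `P`-class.
  coequalizer-≤ : ∀ {c d} → Coequalizer s t c → Coequalizer s t d → c ℕ.≤ d
  coequalizer-≤ P Q = injective⇒≤ {f = quot Q ∘ rep P} λ {x} {y} eq → begin
    x                                        ≡⟨ back x ⟨
    quot P (rep Q (quot Q (rep P x)))        ≡⟨ ≡.cong (quot P ∘ rep Q) eq ⟩
    quot P (rep Q (quot Q (rep P y)))        ≡⟨ back y ⟩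
    y                                        ∎
    where
    open ≡.≡-Reasoning
    back : ∀ x → quot P (rep Q (quot Q (rep P x))) ≡ x
    back x = ≡.trans (universal Q (quot P) (equalizes P) (rep P x)) (quot-rep P x)

  coequalizer-unique : ∀ {c d} → Coequalizer s t c → Coequalizer s t d → c ≡ d
  coequalizer-unique P Q = ℕ.≤-antisym (coequalizer-≤ P Q) (coequalizer-≤ Q P)

module Contraction {m} {u v : Fin (suc m)} (v≢u : v ≢ u) where

  merge : Fin (suc m) → Fin m
  merge x with v ≟ x
  ... | yes _   = punchOut v≢u
  ... | no  v≢x = punchOut v≢x

  merge-punchIn : ∀ y → merge (punchIn v y) ≡ y
  merge-punchIn y with v ≟ punchIn v y
  ... | yes v≡  = contradiction (≡.sym v≡) (punchInᵢ≢i v y)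
  ... | no  v≢x = ≡.trans (punchOut-cong v ≡.refl) (punchOut-punchIn v)


  -- `punchIn v` inverts `merge` except that `v` comes back as `u`. A function with equal values at
  -- `u` and `v` does not notice this, and such functions are all that is needed after contraction.
  punchIn-merge : ∀ x → punchIn v (merge x) ≡ x ⊎ (x ≡ v × punchIn v (merge x) ≡ u)
  punchIn-merge x with v ≟ x
  ... | yes v≡x = inj₂ (≡.sym v≡x , punchIn-punchOut v≢u)
  ... | no  v≢x = inj₁ (punchIn-punchOut v≢x)

  merge-endpoints : merge u ≡ merge v
  merge-endpoints with v ≟ u | v ≟ v
  ... | yes v≡u | _      = contradiction v≡u v≢u
  ... | no  _   | yes _  = punchOut-cong v ≡.refl
  ... | no  _   | no v≢v = contradiction ≡.refl v≢v

module _ {k m} (s t : Fin (suc k) → Fin m) where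
  open Coequalizer

  coequalizer-loop : ∀ {c} → s zero ≡ t zero →
    Coequalizer (s ∘ suc) (t ∘ suc) c → Coequalizer s t c
  coequalizer-loop loop Q = record
    { quot      = quot Q
    ; rep       = rep Q
    ; quot-rep  = quot-rep Q
    ; equalizes = λ { zero → ≡.cong (quot Q) loop ; (suc e) → equalizes Q e }
    ; universal = λ f eq → universal Q f (eq ∘ suc)
    }

module _ {k m} (s t : Fin (suc k) → Fin (suc m)) (t≢s : t zero ≢ s zero) where
  open Coequalizer
  open Contraction t≢s

  coequalizer-contract : ∀ {c} →
    Coequalizer (merge ∘ s ∘ suc) (merge ∘ t ∘ suc) c → Coequalizer s t c
  coequalizer-contract Q = record
    { quot      = quot Q ∘ merge
    ; rep       = punchIn (t zero) ∘ rep Q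
    ; quot-rep  = λ y → ≡.trans (≡.cong (quot Q) (merge-punchIn (rep Q y))) (quot-rep Q y)
    ; equalizes = λ { zero → ≡.cong (quot Q) merge-endpoints ; (suc e) → equalizes Q e }
    ; universal = λ f eq x →
        let section : ∀ y → f (punchIn (t zero) (merge y)) ≡ f y
            section y =
              [ ≡.cong f
              , (λ { (≡.refl , eq′) → ≡.trans (≡.cong f eq′) (eq zero) })
              ]′ (punchIn-merge y)
        in ≡.trans
             (universal Q (f ∘ punchIn (t zero))
               (λ e → ≡.trans (section _) (≡.trans (eq (suc e)) (≡.sym (section _)))) (merge x))
             (section x)
    }

-- Cycle spaces of finite multigraphs

module CycleSpace {c₀ ℓ} (R : CommutativeRing c₀ ℓ) where
  open CommutativeRing R hiding (zero)
  open RingProperties ring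
  open SemiringSum semiring
  open import Relation.Binary.Reasoning.Setoid setoid

  -- The same conditional as in `e`, so `e K n i j` is definitionally the bracket of the decision of
  -- `i ≡ j`, and the bracket lemmas apply to elementary paths.
  [_] : ∀ {p} {P : Set p} → Dec P → Carrier
  [ P? ] = if does P? then 1# else 0#

  module _ {p} {P : Set p} (P? : Dec P) where

    []-true : P → [ P? ] ≈ 1#
    []-true x = reflexive (≡.cong (if_then 1# else 0#) (dec-true P? x))

    []-false : ¬ P → [ P? ] ≈ 0#
    []-false ¬x = reflexive (≡.cong (if_then 1# else 0#) (dec-false P? ¬x))

  []-cong : ∀ {p q} {P : Set p} {Q : Set q} (P? : Dec P) (Q? : Dec Q) →
            (P → Q) → (Q → P) → [ P? ] ≈ [ Q? ]
  []-cong P? (yes q) f g = []-true P? (g q)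
  []-cong P? (no ¬q) f g = []-false P? (¬q ∘ f)

  sum-cong : ∀ {n} {f g : Vector Carrier n} → (∀ i → f i ≈ g i) → sum f ≈ sum g
  sum-cong = sum-cong-≋

  sum-zero : ∀ {n} {f : Vector Carrier n} → (∀ i → f i ≈ 0#) → sum f ≈ 0#
  sum-zero {n} f≈0 = trans (sum-cong f≈0) (sum-replicate-zero n)

  sum-single : ∀ {n} (f : Vector Carrier n) i → (∀ j → j ≢ i → f j ≈ 0#) → sum f ≈ f i
  sum-single f zero    f≈0 = trans (+-congˡ (sum-zero λ j → f≈0 (suc j) λ ())) (+-identityʳ _)
  sum-single f (suc i) f≈0 =
    trans (+-cong (f≈0 zero λ ()) (sum-single (f ∘ suc) i λ j j≢i → f≈0 (suc j) (j≢i ∘ suc-injective)))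
          (+-identityˡ _)

  infix 9 ⟨_,_⟩
  ⟨_,_⟩ : ∀ {k} → Vector Carrier k → Vector Carrier k → Carrier
  ⟨ c , w ⟩ = sum λ e → c e * w e

  combination : ∀ {a} {A : Set a} {d} → Vector Carrier d → Vector (A → Carrier) d → A → Carrier
  combination x v j = sum λ i → x i * v i j

  ⟨⟩-cong : ∀ {k} {c c′ w w′ : Vector Carrier k} → (∀ e → c e ≈ c′ e) → (∀ e → w e ≈ w′ e) → ⟨ c , w ⟩ ≈ ⟨ c′ , w′ ⟩
  ⟨⟩-cong p q = sum-cong λ e → *-cong (p e) (q e)

  -- Associativity of a product of a row vector with two matrices. Pairing with a single vector is
  -- the case of a one-element column index, which is why `Fin 1` appears in the applications.
  combination-assoc : ∀ {a} {A : Set a} {d k} (x : Vector Carrier d) (v : Vector (Vector Carrier k) d)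
    (w : Vector (A → Carrier) k) j → combination (combination x v) w j ≈ combination x (λ i → combination (v i) w) j
  combination-assoc {k = k} x v w j = begin
    sum (λ e → sum (λ i → x i * v i e) * w e j)    ≈⟨ sum-cong (λ e → *-distribʳ-sum (w e j) (λ i → x i * v i e)) ⟩
    sum (λ e → sum (λ i → x i * v i e * w e j))    ≈⟨ ∑-comm (λ e i → x i * v i e * w e j) ⟩
    sum (λ i → sum (λ e → x i * v i e * w e j))    ≈⟨ sum-cong (λ i → sum-cong {n = k} (λ e → *-assoc (x i) (v i e) (w e j))) ⟩
    sum (λ i → sum (λ e → x i * (v i e * w e j)))  ≈⟨ sum-cong (λ i → sym (*-distribˡ-sum (x i) (λ e → v i e * w e j))) ⟩
    sum (λ i → x i * sum (λ e → v i e * w e j))    ∎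

  HasBasis : ∀ {k p} → Pred (Vector Carrier k) p → ℕ → Set _
  HasBasis {k} P d = ∃ λ (v : Vector (Vector Carrier k) d) →
    (∀ i → P (v i)) ×
    (∀ x → (∀ e → combination x v e ≈ 0#) → ∀ i → x i ≈ 0#) ×
    (∀ c → P c → ∃[ x ] ∀ e → c e ≈ combination x v e)

  -- Testing against all potentials φ instead of at each vertex makes the contraction
  -- of an edge a restriction to the potentials with equal values at its ends.
  Flow : ∀ {k m} (s t : Fin k → Fin m) → Pred (Vector Carrier k) _
  Flow {k} {m} s t c = ∀ (φ : Vector Carrier m) → ⟨ c , (λ e → φ (s e) - φ (t e)) ⟩ ≈ 0#

  module _ {k m} (s t : Fin (suc k) → Fin m) (s≡t : s zero ≡ t zero) where

    loop-term : ∀ (c : Carrier) (φ : Vector Carrier m) → c * (φ (s zero) - φ (t zero)) ≈ 0#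
    loop-term c φ = begin
      c * (φ (s zero) - φ (t zero)) ≈⟨ *-congˡ (+-congʳ (reflexive (≡.cong φ s≡t))) ⟩
      c * (φ (t zero) - φ (t zero)) ≈⟨ *-congˡ (-‿inverseʳ _) ⟩
      c * 0#                        ≈⟨ zeroʳ c ⟩
      0#                            ∎

    -- Every potential difference along a loop is zero, so its coefficient is free: the loop alone
    -- is one new basis flow and the remaining edges are unaffected.
    basis-loop : ∀ {d} → HasBasis (Flow (s ∘ suc) (t ∘ suc)) d → HasBasis (Flow s t) (suc d)
    basis-loop {d} (v , v∈ , indep , span) = v′ , v′∈ , indep′ , span′
      where
      v′ : Vector (Vector Carrier _) _
      v′ = (1# ◂ λ _ → 0#) ◂ λ i → 0# ◂ v i

      v′∈ : ∀ i → Flow s t (v′ i)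
      v′∈ zero    φ = trans (+-cong (loop-term 1# φ) (sum-zero {n = k} λ e → zeroˡ _)) (+-identityˡ _)
      v′∈ (suc i) φ = trans (+-cong (loop-term 0# φ) (v∈ i φ)) (+-identityˡ _)

      at-zero : ∀ x → combination x v′ zero ≈ x zero
      at-zero x = trans (+-cong (*-identityʳ _) (sum-zero {n = d} λ i → zeroʳ _)) (+-identityʳ _)

      at-suc : ∀ x e → combination x v′ (suc e) ≈ combination (tail x) v e
      at-suc x e = trans (+-congʳ (zeroʳ _)) (+-identityˡ _)

      indep′ : ∀ x → (∀ e → combination x v′ e ≈ 0#) → ∀ i → x i ≈ 0#
      indep′ x x≈0 zero    = trans (sym (at-zero x)) (x≈0 zero)
      indep′ x x≈0 (suc i) = indep (tail x) (λ e → trans (sym (at-suc x e)) (x≈0 (suc e))) i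

      span′ : ∀ c → Flow s t c → ∃[ x ] ∀ e → c e ≈ combination x v′ e
      span′ c c∈ with span (tail c) (λ φ → trans (sym (trans (+-congʳ (loop-term (c zero) φ)) (+-identityˡ _))) (c∈ φ))
      ... | x , eq = (c zero ◂ x) , λ
        { zero    → sym (at-zero (c zero ◂ x))
        ; (suc e) → trans (eq e) (sym (at-suc (c zero ◂ x) e)) }

  module _ {k m} (s t : Fin (suc k) → Fin (suc m)) (t≢s : t zero ≢ s zero) where
    open Contraction t≢s

    private
      u = s zero
      v = t zero

      δᵤ : Vector Carrier (suc m)
      δᵤ x = [ u ≟ x ]

    -- Testing a flow against δᵤ expresses its value on the contracted edge by the others.
    determined : Vector Carrier k → Carrier
    determined c = ⟨ c , (λ e → δᵤ (t (suc e)) - δᵤ (s (suc e))) ⟩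

    flow-contract : ∀ {c} → Flow s t c → Flow (merge ∘ s ∘ suc) (merge ∘ t ∘ suc) (tail c)
    flow-contract {c} c∈ φ = begin
      X              ≈⟨ +-identityˡ X ⟨
      0# + X         ≈⟨ +-congʳ (zeroʳ _) ⟨
      c zero * 0# + X ≈⟨ +-congʳ (*-congˡ (trans (+-congʳ (reflexive (≡.cong φ merge-endpoints))) (-‿inverseʳ _))) ⟨
      c zero * (φ (merge u) - φ (merge v)) + X ≈⟨ c∈ (φ ∘ merge) ⟩
      0# ∎
      where X = ⟨ tail c , (λ e → φ (merge (s (suc e))) - φ (merge (t (suc e)))) ⟩

    flow-determined : ∀ {c} → Flow s t c → c zero ≈ determined (tail c)
    flow-determined {c} c∈ = begin
      c zero                             ≈⟨ *-identityʳ _ ⟨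
      c zero * 1#                        ≈⟨ *-congˡ δᵤ-difference ⟨
      c zero * (δᵤ u - δᵤ v)             ≈⟨ +-identityʳ _ ⟨
      c zero * (δᵤ u - δᵤ v) + 0#        ≈⟨ +-congˡ total ⟨
      c zero * (δᵤ u - δᵤ v) + (X + determined (tail c)) ≈⟨ +-assoc _ _ _ ⟨
      c zero * (δᵤ u - δᵤ v) + X + determined (tail c) ≈⟨ +-congʳ (c∈ δᵤ) ⟩
      0# + determined (tail c)           ≈⟨ +-identityˡ _ ⟩
      determined (tail c)                ∎
      where
      δᵤ-difference : δᵤ u - δᵤ v ≈ 1#
      δᵤ-difference = trans
        (+-cong ([]-true (u ≟ u) ≡.refl) (trans (-‿cong ([]-false (u ≟ v) (t≢s ∘ ≡.sym))) -0#≈0#))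
        (+-identityʳ _)

      opposite : ∀ p q → (p - q) + (q - p) ≈ 0#
      opposite p q = trans (+-congˡ (sym (⁻¹-anti-homo‿- p q))) (-‿inverseʳ _)

      X = ⟨ tail c , (λ e → δᵤ (s (suc e)) - δᵤ (t (suc e))) ⟩

      total : X + determined (tail c) ≈ 0#
      total = trans
        (sym (∑-distrib-+ (λ e → c (suc e) * (δᵤ (s (suc e)) - δᵤ (t (suc e)))) _))
        (sum-zero {n = k} λ e → trans (sym (distribˡ _ _ _)) (trans (*-congˡ (opposite _ _)) (zeroʳ _)))

    -- An arbitrary potential `φ` is changed at `u` alone, from `φ u` to `φ v`. The resulting `ψ`
    -- has equal values at the ends of the contracted edge, so it descends to the contracted graph;
    -- the term `determined c * r` is exactly what the change costs on the other edges.
    flow-extend : ∀ {c} → Flow (merge ∘ s ∘ suc) (merge ∘ t ∘ suc) c → Flow s t (determined c ◂ c)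
    flow-extend {c} c∈ φ = begin
      determined c * r + ⟨ c , (λ e → φ (s (suc e)) - φ (t (suc e))) ⟩
        ≈⟨ +-congʳ (*-distribʳ-sum r (λ e → c e * (δᵤ (t (suc e)) - δᵤ (s (suc e))))) ⟩
      sum (λ e → c e * (δᵤ (t (suc e)) - δᵤ (s (suc e))) * r) + ⟨ c , (λ e → φ (s (suc e)) - φ (t (suc e))) ⟩
        ≈⟨ ∑-distrib-+ (λ e → c e * (δᵤ (t (suc e)) - δᵤ (s (suc e))) * r) _ ⟨
      sum (λ e → c e * (δᵤ (t (suc e)) - δᵤ (s (suc e))) * r + c e * (φ (s (suc e)) - φ (t (suc e))))
        ≈⟨ sum-cong (λ e → trans (+-congʳ (*-assoc _ _ _))
             (trans (sym (distribˡ _ _ _)) (*-congˡ (absorb (s (suc e)) (t (suc e)))))) ⟩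
      ⟨ c , (λ e → ψ (s (suc e)) - ψ (t (suc e))) ⟩
        ≈⟨ ⟨⟩-cong {c = c} (λ e → refl) (λ e → +-cong (ψ-section _) (-‿cong (ψ-section _))) ⟩
      ⟨ c , (λ e → ψ (punchIn v (merge (s (suc e)))) - ψ (punchIn v (merge (t (suc e))))) ⟩
        ≈⟨ c∈ (ψ ∘ punchIn v) ⟩
      0# ∎
      where
      r = φ u - φ v

      ψ : Vector Carrier (suc m)
      ψ x = φ x - δᵤ x * r

      ψ-endpoints : ψ v ≈ ψ u
      ψ-endpoints = begin
        φ v - δᵤ v * r      ≈⟨ +-congˡ (-‿cong (trans (*-congʳ ([]-false (u ≟ v) (t≢s ∘ ≡.sym))) (zeroˡ r))) ⟩
        φ v - 0#            ≈⟨ trans (+-congˡ -0#≈0#) (+-identityʳ _) ⟩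
        φ v                 ≈⟨ trans (sym (+-identityˡ _)) (+-congʳ (sym (-‿inverseʳ (φ u)))) ⟩
        φ u - φ u + φ v     ≈⟨ +-assoc _ _ _ ⟩
        φ u + (- φ u + φ v) ≈⟨ +-congˡ (trans (⁻¹-anti-homo‿- _ _) (+-comm _ _)) ⟨
        φ u - r             ≈⟨ +-congˡ (-‿cong (trans (*-congʳ ([]-true (u ≟ u) ≡.refl)) (*-identityˡ r))) ⟨
        φ u - δᵤ u * r      ∎

      ψ-section : ∀ x → ψ x ≈ ψ (punchIn v (merge x))
      ψ-section x with punchIn-merge x
      ... | inj₁ eq           = reflexive (≡.cong ψ (≡.sym eq))
      ... | inj₂ (≡.refl , eq) = trans ψ-endpoints (reflexive (≡.cong ψ (≡.sym eq)))

      absorb : ∀ x y → (δᵤ y - δᵤ x) * r + (φ x - φ y) ≈ ψ x - ψ y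
      absorb x y = begin
        (δᵤ y - δᵤ x) * r + (φ x - φ y)             ≈⟨ +-congʳ (distribʳ _ _ _) ⟩
        (δᵤ y * r + - δᵤ x * r) + (φ x - φ y)       ≈⟨ +-congʳ (+-congˡ (sym (-‿distribˡ-* _ _))) ⟩
        (δᵤ y * r - δᵤ x * r) + (φ x - φ y)         ≈⟨ +-comm _ _ ⟩
        (φ x - φ y) + (δᵤ y * r - δᵤ x * r)         ≈⟨ +-congˡ (+-comm _ _) ⟩
        (φ x - φ y) + (- (δᵤ x * r) + δᵤ y * r)     ≈⟨ +-assoc _ _ _ ⟩
        φ x + (- φ y + (- (δᵤ x * r) + δᵤ y * r))   ≈⟨ +-congˡ (+-assoc _ _ _) ⟨
        φ x + ((- φ y - δᵤ x * r) + δᵤ y * r)       ≈⟨ +-congˡ (+-congʳ (+-comm _ _)) ⟩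
        φ x + ((- (δᵤ x * r) - φ y) + δᵤ y * r)     ≈⟨ +-congˡ (+-assoc _ _ _) ⟩
        φ x + (- (δᵤ x * r) + (- φ y + δᵤ y * r))   ≈⟨ +-assoc _ _ _ ⟨
        ψ x + (- φ y + δᵤ y * r)                    ≈⟨ +-congˡ (trans (⁻¹-anti-homo‿- _ _) (+-comm _ _)) ⟨
        ψ x - ψ y                                   ∎

    -- Forgetting the contracted edge is an isomorphism of flow spaces, with inverse
    -- `determined c ◂ c`; independence can therefore be read off on the other edges.
    basis-contract : ∀ {d} → HasBasis (Flow (merge ∘ s ∘ suc) (merge ∘ t ∘ suc)) d → HasBasis (Flow s t) d
    basis-contract {d} (b , b∈ , indep , span) =
      (λ i → determined (b i) ◂ b i) , (λ i → flow-extend {b i} (b∈ i)) , (λ x x≈0 → indep x (x≈0 ∘ suc)) , span′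
      where
      span′ : ∀ c → Flow s t c → ∃[ x ] ∀ e → c e ≈ combination x (λ i → determined (b i) ◂ b i) e
      span′ c c∈ with span (tail c) (flow-contract {c} c∈)
      ... | x , eq = x , λ
        { zero    → begin
            c zero                         ≈⟨ flow-determined {c} c∈ ⟩
            determined (tail c)            ≈⟨ ⟨⟩-cong {c = tail c} eq (λ e → refl) ⟩
            determined (combination x b)
              -- `determined` is pairing with a fixed vector, hence linear.
              ≈⟨ combination-assoc x b (λ e (_ : Fin 1) → δᵤ (t (suc e)) - δᵤ (s (suc e))) zero ⟩
            sum (λ i → x i * determined (b i)) ∎
        ; (suc e) → eq e }

  basis-empty : ∀ {m} (s t : Fin 0 → Fin m) → HasBasis (Flow s t) 0
  basis-empty s t = (λ ()) , (λ ()) , (λ _ _ ()) , λ _ _ → (λ ()) , λ ()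

  -- Euler's relation, by induction on the edges: a loop raises `d` and `k` by one, a contraction
  -- accounts for one edge and one vertex, and without edges every vertex is its own class.
  cycle-space : ∀ {k m} (s t : Fin k → Fin m) →
    ∃₂ λ d c → HasBasis (Flow s t) d × Coequalizer s t c × d ℕ.+ m ≡ k ℕ.+ c
  cycle-space {zero} {m} s t = 0 , m , basis-empty s t , record
    { quot = id ; rep = id ; quot-rep = λ _ → ≡.refl ; equalizes = λ () ; universal = λ _ _ _ → ≡.refl } , ≡.refl
  cycle-space {suc k} {m} s t with t zero ≟ s zero
  cycle-space {suc k} {m} s t | yes t≡s with cycle-space (s ∘ suc) (t ∘ suc)
  ... | d , c , B , Q , eq =
    suc d , c , basis-loop s t (≡.sym t≡s) B , coequalizer-loop s t (≡.sym t≡s) Q , ≡.cong suc eq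
  cycle-space {suc k} {zero} s t | no _ with () ← s zero
  cycle-space {suc k} {suc m} s t | no t≢s
    with cycle-space (Contraction.merge t≢s ∘ s ∘ suc) (Contraction.merge t≢s ∘ t ∘ suc)
  ... | d , c , B , Q , eq =
    d , c , basis-contract s t t≢s B , coequalizer-contract s t t≢s Q , ≡.trans (ℕ.+-suc d m) (≡.cong suc eq)

-- Enumerations of paths

record Enumeration {a p} {A : Set a} (P : Pred A p) : Set (a Level.⊔ p) where
  field
    size      : ℕ
    at        : Fin size → A
    sound     : ∀ k → P (at k)
    complete  : ∀ {x} → P x → ∃[ k ] at k ≡ x
    injective : Injective _≡_ _≡_ at

module _ {a} {A : Set a} where

  lookup-injective : ∀ {xs : List A} → Unique xs → Injective _≡_ _≡_ (List.lookup xs)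
  lookup-injective (_ ∷ _)   {zero}  {zero}  _  = ≡.refl
  lookup-injective (x∉ ∷ _)  {zero}  {suc j} eq = contradiction eq (All.lookup x∉ (∈-lookup j))
  lookup-injective (x∉ ∷ _)  {suc i} {zero}  eq = contradiction (≡.sym eq) (All.lookup x∉ (∈-lookup i))
  lookup-injective (_ ∷ xs!) {suc i} {suc j} eq = ≡.cong suc (lookup-injective xs! eq)

  enumerateList : ∀ {xs : List A} → Unique xs → Enumeration (_∈ˡ xs)
  enumerateList {xs} xs! = record
    { size      = List.length xs
    ; at        = List.lookup xs
    ; sound     = ∈-lookup
    ; complete  = λ x∈xs → Any.index x∈xs , ≡.sym (lookup-index x∈xs)
    ; injective = lookup-injective xs!
    }

  enumeration-resp : ∀ {p q} {P : Pred A p} {Q : Pred A q} →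
    (∀ {x} → P x → Q x) → (∀ {x} → Q x → P x) → Enumeration P → Enumeration Q
  enumeration-resp P⊆Q Q⊆P ε = record
    { size      = size
    ; at        = at
    ; sound     = P⊆Q ∘ sound
    ; complete  = complete ∘ Q⊆P
    ; injective = injective
    }
    where open Enumeration ε

module _ {n : ℕ} where

  allVecs : ∀ m → List (Vec (Fin n) m)
  allVecs zero    = [] List.∷ List.[]
  allVecs (suc m) = cartesianProductWith _∷_ (allFin n) (allVecs m)

  ∈-allVecs : ∀ {m} (i : Vec (Fin n) m) → i ∈ˡ allVecs m
  ∈-allVecs []      = here ≡.refl
  ∈-allVecs (v ∷ i) = ∈-cartesianProductWith⁺ _∷_ (∈-allFin v) (∈-allVecs i)

  allVecs-unique : ∀ m → Unique (allVecs m)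
  allVecs-unique zero    = All.[] ∷ []
  allVecs-unique (suc m) = cartesianProductWith⁺ _∷_ ∷-injective (allFin⁺ n) (allVecs-unique m)

  enumerateVecs : ∀ {m p} {P : Pred (Vec (Fin n) m) p} → Decidable P → Enumeration P
  enumerateVecs {m} P? = enumeration-resp (proj₂ ∘ ∈-filter⁻ P? {xs = allVecs m}) (∈-filter⁺ P? (∈-allVecs _))
    (enumerateList (filter⁺ P? (allVecs-unique m)))

  irregular? : ∀ {p} → Decidable (Irregular {n} {p})
  irregular? i = any? λ k → lookup i (inject₁ k) ≟ lookup i (suc k)

module _ {n ℓ} (G : Digraph n ℓ) where
  open Digraph G

  allowed? : ∀ {p} → Decidable (Allowed {n} {p} G)
  allowed? i = all? λ k → lookup i (inject₁ k) ⟶? lookup i (suc k)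

  allowed⇒regular : ∀ {p} {i : Path n p} → Allowed G i → ¬ Irregular i
  allowed⇒regular {i = i} i↑ (k , eq) = loopless _ (≡.subst (lookup i (inject₁ k) ⟶_) (≡.sym eq) (i↑ k))

  Through : (a b : Fin n) → Pred (Path n 3) ℓ
  Through a b i = Allowed G i × head i ≡ a × last i ≡ b

  -- The y for which e_{ayb} has to cancel in the boundary: it may occur in the
  -- boundary of a path of Through a b, is regular and is not allowed.
  Inner : (a b : Fin n) → Pred (Fin n) ℓ
  Inner a b y = y ≢ a × y ≢ b × ¬ (a ⟶ y × y ⟶ b) × (a ⟶ y ⊎ y ⟶ b)

-- Regular chains, their boundaries, and `Ω₃` as a space of conserved weights

module Chains {c ℓ₁ ℓ₂} (K : HeytingField c ℓ₁ ℓ₂) (n : ℕ) where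
  open HeytingField K using (heytingCommutativeRing; _#_; tight; #-irrefl)
  open HeytingCommutativeRing heytingCommutativeRing using (commutativeRing)
  open CommutativeRing commutativeRing hiding (zero)
  open RingProperties ring
  open SemiringSum semiring
  open SemiringExp semiring using (_^_)
  open CycleSpace commutativeRing
  open import Relation.Binary.Reasoning.Setoid setoid

  _≟ᵖ_ : ∀ {m} (i j : Vec (Fin n) m) → Dec (i ≡ j)
  _≟ᵖ_ = ≡-dec _≟_

  x-0≈x : ∀ x → x - 0# ≈ x
  x-0≈x x = trans (+-congˡ -0#≈0#) (+-identityʳ x)

  x-y≈0⇒x≈y : ∀ {x y} → x - y ≈ 0# → x ≈ y
  x-y≈0⇒x≈y {x} {y} eq = trans (+-inverseˡ-unique x (- y) eq) (-‿involutive y)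

  x≈y⇒x-y≈0 : ∀ {x y} → x ≈ y → x - y ≈ 0#
  x≈y⇒x-y≈0 {x} {y} eq = trans (+-congʳ eq) (-‿inverseʳ y)

  zero-difference : ∀ {r x y} → x ≈ 0# → y ≈ 0# → r * (x - y) ≈ 0#
  zero-difference x≈0 y≈0 = trans (*-congˡ (x≈y⇒x-y≈0 (trans x≈0 (sym y≈0)))) (zeroʳ _)

  module _ {p m} (x : Vector Carrier m) (i : Fin m → Path n p) where

    combination-at : Injective _≡_ _≡_ i → ∀ k → combination x (e K n ∘ i) (i k) ≈ x k
    combination-at inj k = begin
      combination x (e K n ∘ i) (i k)
        ≈⟨ sum-single (λ l → x l * e K n (i l) (i k)) k (λ l l≢k →
             trans (*-congˡ ([]-false (i l ≟ᵖ i k) (l≢k ∘ inj))) (zeroʳ _)) ⟩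
      x k * e K n (i k) (i k)           ≈⟨ *-congˡ ([]-true (i k ≟ᵖ i k) ≡.refl) ⟩
      x k * 1#                          ≈⟨ *-identityʳ _ ⟩
      x k                               ∎

    combination-off : ∀ j → (∀ k → i k ≢ j) → combination x (e K n ∘ i) j ≈ 0#
    combination-off j i≢j = sum-zero {n = m} λ k → trans (*-congˡ ([]-false (i k ≟ᵖ j) (i≢j k))) (zeroʳ (x k))

  combination-enumerated : ∀ {p ℓ} {P : Pred (Path n p) ℓ} (ε : Enumeration P) (u : Λ K n p) {j} → P j →
    combination (u ∘ Enumeration.at ε) (e K n ∘ Enumeration.at ε) j ≈ u j
  combination-enumerated ε u Pj with Enumeration.complete ε Pj
  ... | k , ≡.refl = combination-at (u ∘ at) at injective k
    where open Enumeration ε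

  I⇒vanishes : ∀ {p} {u : Λ K n p} → I K n p u → ∀ j → ¬ Irregular j → u j ≈ 0#
  I⇒vanishes (m , x , i , irr , eq) j reg =
    trans (eq j) (combination-off x i j λ k → λ { ≡.refl → reg (irr k) })

  -- There are finitely many irregular paths, so such a `u` is their combination with its own values
  -- as coefficients. With the converse above, equality in the quotient becomes equality of
  -- coefficients at regular paths.
  vanishes⇒I : ∀ {p} {u : Λ K n p} → (∀ j → ¬ Irregular j → u j ≈ 0#) → I K n p u
  vanishes⇒I {p} {u} u≈0 = size , u ∘ at , at , sound , eq
    where
    ε : Enumeration (Irregular {n} {p})
    ε = enumerateVecs irregular?
    open Enumeration ε
    eq : ∀ j → u j ≈ combination (u ∘ at) (e K n ∘ at) j
    eq j with irregular? j
    ... | yes irr = sym (combination-enumerated ε u irr)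
    ... | no reg  = trans (u≈0 j reg) (sym (combination-off (u ∘ at) at j λ k → λ { ≡.refl → reg (sound k) }))

  sumAll-cong : ∀ {m} {f g : Vec (Fin n) m → Carrier} → (∀ i → f i ≈ g i) → sumAll K n f ≈ sumAll K n g
  sumAll-cong {zero}  eq = eq []
  sumAll-cong {suc m} eq = sum-cong {n = n} λ v → sumAll-cong λ i → eq (v ∷ i)

  sumAll-zero : ∀ {m} {f : Vec (Fin n) m → Carrier} → (∀ i → f i ≈ 0#) → sumAll K n f ≈ 0#
  sumAll-zero {zero}  eq = eq []
  sumAll-zero {suc m} eq = sum-zero {n = n} λ v → sumAll-zero λ i → eq (v ∷ i)

  sumAll-single : ∀ {m} (f : Vec (Fin n) m → Carrier) i → (∀ j → j ≢ i → f j ≈ 0#) → sumAll K n f ≈ f i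
  sumAll-single f []      f≈0 = refl
  sumAll-single f (v ∷ i) f≈0 = trans
    (sum-single (λ w → sumAll K n λ j → f (w ∷ j)) v λ w w≢v → sumAll-zero λ j → f≈0 (w ∷ j) (w≢v ∘ proj₁ ∘ ∷-injective))
    (sumAll-single (f ∘ (v ∷_)) i λ j j≢i → f≈0 (v ∷ j) (j≢i ∘ proj₂ ∘ ∷-injective))

  sumAll-sum : ∀ {m k} (f : Fin k → Vec (Fin n) m → Carrier) →
    sumAll K n (λ i → sum λ l → f l i) ≈ sum λ l → sumAll K n (f l)
  sumAll-sum {zero}  f = refl
  sumAll-sum {suc m} f = trans
    (sum-cong {n = n} λ v → sumAll-sum λ l i → f l (v ∷ i))
    (∑-comm λ v l → sumAll K n λ i → f l (v ∷ i))

  sumAll-enumerated : ∀ {p ℓ} {P : Pred (Path n p) ℓ} → Decidable P → (ε : Enumeration P) → (f : Λ K n p) →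
    (∀ i → ¬ P i → f i ≈ 0#) → sumAll K n f ≈ sum (f ∘ Enumeration.at ε)
  sumAll-enumerated {P = P} P? ε f f≈0 = begin
    sumAll K n f
      ≈⟨ sumAll-cong expand ⟩
    sumAll K n (λ i → sum λ k → f (at k) * e K n (at k) i)
      ≈⟨ sumAll-sum (λ k i → f (at k) * e K n (at k) i) ⟩
    sum (λ k → sumAll K n λ i → f (at k) * e K n (at k) i)
      ≈⟨ sum-cong {n = size} (λ k → trans
           (sumAll-single (λ i → f (at k) * e K n (at k) i) (at k) λ i i≢ →
             trans (*-congˡ ([]-false (at k ≟ᵖ i) (i≢ ∘ ≡.sym))) (zeroʳ _))
           (trans (*-congˡ ([]-true (at k ≟ᵖ at k) ≡.refl)) (*-identityʳ _))) ⟩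
    sum (f ∘ at)
      ∎
    where
    open Enumeration ε
    expand : ∀ i → f i ≈ combination (f ∘ at) (e K n ∘ at) i
    expand i with P? i
    ... | yes Pi = sym (combination-enumerated ε f Pi)
    ... | no ¬Pi = trans (f≈0 i ¬Pi) (sym (combination-off (f ∘ at) at i λ k → λ { ≡.refl → ¬Pi (sound k) }))

  ∂e-path : ∀ w x y z (q : Path n 2) →
    let _at_ = λ v₀ v₁ v₂ → e K n (v₀ ∷ v₁ ∷ v₂ ∷ []) q in
    ∂e K n (w ∷ x ∷ y ∷ z ∷ []) q ≈ (_at_ x y z - _at_ w y z) + (_at_ w x z - _at_ w x y)
  ∂e-path w x y z q = begin
    -- The powers of `- 1#` unfold to products ending in `1#`, and the sum over the faces ends in
    -- `0#`.
    1# * A + (- 1# * 1# * B + (- 1# * (- 1# * 1#) * C + (- 1# * (- 1# * (- 1# * 1#)) * D + 0#)))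
      ≈⟨ +-cong (*-identityˡ A) (+-cong (sign₁ B) (+-cong (sign₂ C) (trans (+-identityʳ _) (sign₃ D)))) ⟩
    A + (- B + (C - D)) ≈⟨ +-assoc _ _ _ ⟨
    (A - B) + (C - D) ∎
    where
    A = e K n (x ∷ y ∷ z ∷ []) q
    B = e K n (w ∷ y ∷ z ∷ []) q
    C = e K n (w ∷ x ∷ z ∷ []) q
    D = e K n (w ∷ x ∷ y ∷ []) q
    sign₁ : ∀ a → - 1# * 1# * a ≈ - a
    sign₁ a = trans (*-congʳ (*-identityʳ _)) (-1*x≈-x a)
    sign-step : ∀ s a → - 1# * s * a ≈ - (s * a)
    sign-step s a = trans (*-assoc _ _ _) (-1*x≈-x (s * a))
    sign₂ : ∀ a → - 1# * (- 1# * 1#) * a ≈ a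
    sign₂ a = trans (sign-step _ a) (trans (-‿cong (sign₁ a)) (-‿involutive a))
    sign₃ : ∀ a → - 1# * (- 1# * (- 1# * 1#)) * a ≈ - a
    sign₃ a = trans (sign-step _ a) (-‿cong (sign₂ a))

  -- Deleting either of two equal neighbours gives the same face with opposite signs, and every
  -- other face is still irregular. This is needed because a representative may have arbitrary
  -- coefficients at irregular paths.
  ∂e-irregular : ∀ (i : Path n 3) (q : Path n 2) → Irregular i → ¬ Irregular q → ∂e K n i q ≈ 0#
  ∂e-irregular (w ∷ x ∷ y ∷ z ∷ []) q irr reg = trans (∂e-path w x y z q) (cases irr)
    where
    off : ∀ (j : Path n 2) → Irregular j → e K n j q ≈ 0#
    off j irr = []-false (j ≟ᵖ q) λ { ≡.refl → reg irr }
    off₀ : ∀ u v → e K n (u ∷ u ∷ v ∷ []) q ≈ 0#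
    off₀ u v = off (u ∷ u ∷ v ∷ []) (zero , ≡.refl)
    off₁ : ∀ u v → e K n (u ∷ v ∷ v ∷ []) q ≈ 0#
    off₁ u v = off (u ∷ v ∷ v ∷ []) (suc zero , ≡.refl)
    cases : Irregular (w ∷ x ∷ y ∷ z ∷ []) →
      (e K n (x ∷ y ∷ z ∷ []) q - e K n (w ∷ y ∷ z ∷ []) q)
        + (e K n (w ∷ x ∷ z ∷ []) q - e K n (w ∷ x ∷ y ∷ []) q) ≈ 0#
    cases (zero , ≡.refl) = trans
      (+-cong (-‿inverseʳ _) (x≈y⇒x-y≈0 (trans (off₀ x z) (sym (off₀ x y)))))
      (+-identityˡ 0#)
    cases (suc zero , ≡.refl) = begin
      (e K n (x ∷ x ∷ z ∷ []) q - B) + (B - e K n (w ∷ x ∷ x ∷ []) q)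
                         ≈⟨ +-cong (trans (+-congʳ (off₀ x z)) (+-identityˡ _))
                                   (trans (+-congˡ (-‿cong (off₁ w x))) (x-0≈x B)) ⟩
      - B + B            ≈⟨ -‿inverseˡ B ⟩
      0#                 ∎
      where
      B = e K n (w ∷ x ∷ z ∷ []) q
    cases (suc (suc zero) , ≡.refl) = trans
      (+-cong (x≈y⇒x-y≈0 (trans (off₁ x y) (sym (off₁ w y)))) (-‿inverseʳ _))
      (+-identityˡ 0#)

  module _ {ℓ} (G : Digraph n ℓ) where
    open Digraph G

    𝒜⇒vanishes : ∀ {p} {u : Λ K n p} → 𝒜 K n G p u → ∀ j → ¬ Irregular j → ¬ Allowed G j → u j ≈ 0#
    𝒜⇒vanishes (m , x , i , i↑ , eq) j reg ¬j↑ = trans (x-y≈0⇒x≈y (I⇒vanishes eq j reg))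
      (combination-off x i j λ k → λ { ≡.refl → ¬j↑ (i↑ k) })

    vanishes⇒𝒜 : ∀ {p} {u : Λ K n p} → (∀ j → ¬ Irregular j → ¬ Allowed G j → u j ≈ 0#) → 𝒜 K n G p u
    vanishes⇒𝒜 {p} {u} u≈0 = size , u ∘ at , at , sound , vanishes⇒I vanishes
      where
      ε : Enumeration (Allowed {n} {p} G)
      ε = enumerateVecs (allowed? G)
      open Enumeration ε
      vanishes : ∀ j → ¬ Irregular j → u j - combination (u ∘ at) (e K n ∘ at) j ≈ 0#
      vanishes j reg with allowed? G j
      ... | yes j↑ = x≈y⇒x-y≈0 (sym (combination-enumerated ε u j↑))
      ... | no ¬j↑ = x≈y⇒x-y≈0 (trans (u≈0 j reg ¬j↑)
                       (sym (combination-off (u ∘ at) at j λ k → λ { ≡.refl → ¬j↑ (sound k) })))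

    module _ (a b : Fin n) where

      Through? : Decidable (Through G a b)
      Through? i = allowed? G i ×-dec head i ≟ a ×-dec last i ≟ b

      module _ {k} (s t : Fin k → Fin n)
        (sound : ∀ e → a ⟶ s e × s e ⟶ t e × t e ⟶ b)
        (complete : ∀ {i j} → a ⟶ i → i ⟶ j → j ⟶ b → ∃[ e ] s e ≡ i × t e ≡ j)
        (injective : ∀ {e f} → s e ≡ s f → t e ≡ t f → e ≡ f) where

        path : Fin k → Path n 3
        path e = a ∷ s e ∷ t e ∷ b ∷ []

        via : Fin n → Path n 2
        via y = a ∷ y ∷ b ∷ []

        enumerateThrough : Enumeration (Through G a b)
        enumerateThrough = record
          { size      = k
          ; at        = path
          ; sound     = λ e → path-allowed (sound e) , ≡.refl , ≡.refl
          ; complete  = complete′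
          ; injective = λ { eq → injective (≡.cong (head ∘ Vec.tail) eq) (≡.cong (head ∘ Vec.tail ∘ Vec.tail) eq) }
          }
          where
          path-allowed : ∀ {i j} → a ⟶ i × i ⟶ j × j ⟶ b → Allowed G (a ∷ i ∷ j ∷ b ∷ [])
          path-allowed (a→i , _ , _) zero             = a→i
          path-allowed (_ , i→j , _) (suc zero)       = i→j
          path-allowed (_ , _ , j→b) (suc (suc zero)) = j→b

          complete′ : ∀ {i} → Through G a b i → ∃[ e ] path e ≡ i
          complete′ {_ ∷ i ∷ j ∷ _ ∷ []} (i↑ , ≡.refl , ≡.refl)
            with complete (i↑ zero) (i↑ (suc zero)) (i↑ (suc (suc zero)))
          ... | e , ≡.refl , ≡.refl = e , ≡.refl

        -- The pairing is the coefficient at e_{ayb} of the boundary of the chain with weights `x`: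
        -- outflow minus inflow at `y`.
        Conserved : Pred (Vector Carrier k) _
        Conserved x = ∀ y → Inner G a b y → ⟨ x , (λ e → [ s e ≟ y ] - [ t e ≟ y ]) ⟩ ≈ 0#

        embed : Vector Carrier k → Λ K n 3
        embed x = combination x (e K n ∘ path)

        embed-path : ∀ x e → embed x (path e) ≈ x e
        embed-path x = combination-at x path (Enumeration.injective enumerateThrough)

        embed-off : ∀ x i → ¬ Through G a b i → embed x i ≈ 0#
        embed-off x i ¬i = combination-off x path i λ e → λ { ≡.refl → ¬i (Enumeration.sound enumerateThrough e) }

        ∂-through : ∀ (u : Λ K n 3) → (∀ i → ¬ Irregular i → ¬ Through G a b i → u i ≈ 0#) →
          ∀ q → ¬ Irregular q → ∂ K n u q ≈ sum λ e → u (path e) * ∂e K n (path e) q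
        ∂-through u u≈0 q reg = sumAll-enumerated Through? enumerateThrough (λ i → u i * ∂e K n i q) vanishes
          where
          vanishes : ∀ i → ¬ Through G a b i → u i * ∂e K n i q ≈ 0#
          vanishes i ¬i with irregular? i
          ... | yes irr = trans (*-congˡ (∂e-irregular i q irr reg)) (zeroʳ _)
          ... | no reg′ = trans (*-congʳ (u≈0 i reg′ ¬i)) (zeroˡ _)

        module _ (q : Path n 2) (¬q↑ : ¬ Allowed G q) where

          -- The two outer faces consist of edges of the path itself, so they are allowed and differ
          -- from `q`. Only the faces from `a` to `b` remain.
          ∂e-through : ∀ e′ → ∂e K n (path e′) q ≈ e K n (a ∷ s e′ ∷ b ∷ []) q - e K n (a ∷ t e′ ∷ b ∷ []) q
          ∂e-through e′ = begin
            ∂e K n (path e′) q                    ≈⟨ ∂e-path a (s e′) (t e′) b q ⟩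
            (stb - atb) + (asb - ast)             ≈⟨ +-cong (trans (+-congʳ stb≈0) (+-identityˡ _))
                                                            (trans (+-congˡ (-‿cong ast≈0)) (x-0≈x _)) ⟩
            - atb + asb                           ≈⟨ +-comm _ _ ⟩
            asb - atb                             ∎
            where
            stb = e K n (s e′ ∷ t e′ ∷ b ∷ []) q
            atb = e K n (a ∷ t e′ ∷ b ∷ []) q
            asb = e K n (a ∷ s e′ ∷ b ∷ []) q
            ast = e K n (a ∷ s e′ ∷ t e′ ∷ []) q
            stb≈0 : stb ≈ 0#
            stb≈0 = []-false ((s e′ ∷ t e′ ∷ b ∷ []) ≟ᵖ q) λ { ≡.refl →
              ¬q↑ λ { zero → proj₁ (proj₂ (sound e′)) ; (suc zero) → proj₂ (proj₂ (sound e′)) } }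
            ast≈0 : ast ≈ 0#
            ast≈0 = []-false ((a ∷ s e′ ∷ t e′ ∷ []) ≟ᵖ q) λ { ≡.refl →
              ¬q↑ λ { zero → proj₁ (sound e′) ; (suc zero) → proj₁ (proj₂ (sound e′)) } }

        middle : ∀ x y → e K n (via x) (via y) ≈ [ x ≟ y ]
        middle x y = []-cong ((via x) ≟ᵖ (via y)) (x ≟ y) (≡.cong (head ∘ Vec.tail)) (≡.cong via)

        through-allowed : ∀ {y} → a ⟶ y × y ⟶ b → Allowed G (via y)
        through-allowed (a→y , _) zero       = a→y
        through-allowed (_ , y→b) (suc zero) = y→b

        allowed-through : ∀ {y} → Allowed G (via y) → a ⟶ y × y ⟶ b
        allowed-through q↑ = q↑ zero , q↑ (suc zero)

        conserved⇒Ω₃ : ∀ {x} → Conserved x → Ω₃ K n G a b (embed x)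
        conserved⇒Ω₃ {x} x∈ =
          (vanishes⇒𝒜 (λ i _ ¬i↑ → embed-off x i (¬i↑ ∘ proj₁)) , vanishes⇒𝒜 boundary) , ends
          where
          ends : ∀ i → ¬ Irregular i → embed x i # 0# → head i ≡ a × last i ≡ b
          ends i _ x#0 with head i ≟ a ×-dec last i ≟ b
          ... | yes eqs = eqs
          ... | no ¬eqs = contradiction x#0 (#-irrefl (embed-off x i (¬eqs ∘ proj₂)))

          boundary′ : ∀ q → ¬ Irregular q → ¬ Allowed G q →
            ∂ K n (embed x) q ≈ ⟨ x , (λ f → e K n (via (s f)) q - e K n (via (t f)) q) ⟩
          boundary′ q reg ¬q↑ = trans (∂-through (embed x) (λ i _ → embed-off x i) q reg)
            (⟨⟩-cong {k} (embed-path x) (∂e-through q ¬q↑))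

          boundary : ∀ q → ¬ Irregular q → ¬ Allowed G q → ∂ K n (embed x) q ≈ 0#
          boundary q@(v ∷ y ∷ w ∷ []) reg ¬q↑ with v ≟ a | w ≟ b
          -- All remaining faces run from `a` to `b`, so a `q` with another end has coefficient
          -- zero.
          ... | no v≢a | _ = trans (boundary′ q reg ¬q↑) (sum-zero {n = k} λ f → zero-difference
                ([]-false (via (s f) ≟ᵖ q) (v≢a ∘ ≡.sym ∘ ≡.cong head))
                ([]-false (via (t f) ≟ᵖ q) (v≢a ∘ ≡.sym ∘ ≡.cong head)))
          ... | yes _ | no w≢b = trans (boundary′ q reg ¬q↑) (sum-zero {n = k} λ f → zero-difference
                ([]-false (via (s f) ≟ᵖ q) (w≢b ∘ ≡.sym ∘ ≡.cong last))
                ([]-false (via (t f) ≟ᵖ q) (w≢b ∘ ≡.sym ∘ ≡.cong last)))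
          ... | yes ≡.refl | yes ≡.refl = trans (boundary′ q reg ¬q↑) (trans
                (⟨⟩-cong {k} {c = x} (λ _ → refl) (λ f → +-cong (middle (s f) y) (-‿cong (middle (t f) y))))
                conserved)
            where
            inner : a ⟶ y ⊎ y ⟶ b → Inner G a b y
            inner edge =
              (λ { ≡.refl → reg (zero , ≡.refl) }) , (λ { ≡.refl → reg (suc zero , ≡.refl) }) ,
              ¬q↑ ∘ through-allowed , edge

            conserved : ⟨ x , (λ f → [ s f ≟ y ] - [ t f ≟ y ]) ⟩ ≈ 0#
            conserved with a ⟶? y | y ⟶? b
            ... | yes a→y | _       = x∈ y (inner (inj₁ a→y))
            ... | no _    | yes y→b = x∈ y (inner (inj₂ y→b))
            -- Here `y` is not `Inner`, but it is no `s f` and no `t f` either, so every term is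
            -- zero.
            ... | no ¬a→y | no ¬y→b = sum-zero {n = k} λ f → zero-difference
                ([]-false (s f ≟ y) λ { ≡.refl → ¬a→y (proj₁ (sound f)) })
                ([]-false (t f ≟ y) λ { ≡.refl → ¬y→b (proj₂ (proj₂ (sound f))) })

        -- `Ω₃` restricts the ends only where the coefficient is apart from zero. At an allowed path
        -- with wrong ends the coefficient is therefore not apart from zero, and tightness makes it
        -- zero.
        Ω₃⇒vanishes : ∀ {u} → Ω₃ K n G a b u → ∀ i → ¬ Irregular i → ¬ Through G a b i → u i ≈ 0#
        Ω₃⇒vanishes {u} ((u∈𝒜 , _) , ends) i reg ¬i with allowed? G i
        ... | yes i↑ = proj₁ (tight (u i) 0#) (¬i ∘ (i↑ ,_) ∘ ends i reg)
        ... | no ¬i↑ = 𝒜⇒vanishes {u = u} u∈𝒜 i reg ¬i↑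

        Ω₃⇒conserved : ∀ {u} → Ω₃ K n G a b u → Conserved (u ∘ path)
        Ω₃⇒conserved {u} u∈ y (y≢a , y≢b , ¬ayb , _) = begin
          ⟨ u ∘ path , (λ f → [ s f ≟ y ] - [ t f ≟ y ]) ⟩
            ≈⟨ ⟨⟩-cong {k} {c = u ∘ path} (λ _ → refl) (λ f → +-cong (middle (s f) y) (-‿cong (middle (t f) y))) ⟨
          ⟨ u ∘ path , (λ f → e K n (via (s f)) q - e K n (via (t f)) q) ⟩
            ≈⟨ ⟨⟩-cong {k} {c = u ∘ path} (λ _ → refl) (∂e-through q ¬q↑) ⟨
          sum (λ f → u (path f) * ∂e K n (path f) q)
            ≈⟨ ∂-through u (Ω₃⇒vanishes {u} u∈) q reg ⟨
          ∂ K n u q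
            ≈⟨ 𝒜⇒vanishes {u = ∂ K n u} (proj₂ (proj₁ u∈)) q reg ¬q↑ ⟩
          0# ∎
          where
          q : Path n 2
          q = via y
          ¬q↑ : ¬ Allowed G q
          ¬q↑ = ¬ayb ∘ allowed-through
          reg : ¬ Irregular q
          reg (zero , a≡y)     = y≢a (≡.sym a≡y)
          reg (suc zero , y≡b) = y≢b y≡b

        Ω₃⇒embed : ∀ {u} → Ω₃ K n G a b u → ∀ i → ¬ Irregular i → u i ≈ embed (u ∘ path) i
        Ω₃⇒embed {u} u∈ i reg with Through? i
        ... | yes i∈ = sym (combination-enumerated enumerateThrough u i∈)
        ... | no ¬i  = trans (Ω₃⇒vanishes {u} u∈ i reg ¬i) (sym (embed-off (u ∘ path) i ¬i))

        basis⇒dimension : ∀ {d} → HasBasis Conserved d → HasDimension K n (Ω₃ K n G a b) d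
        basis⇒dimension {d} (v , v∈ , indep , span) = embed ∘ v , conserved⇒Ω₃ ∘ v∈ , indep′ , span′
          where
          embed-combination : ∀ x i → combination x (embed ∘ v) i ≈ embed (combination x v) i
          embed-combination x i = sym (combination-assoc x v (e K n ∘ path) i)

          indep′ : ∀ x → _≈ᴿ_ K n (lincomb K n x (embed ∘ v)) (λ _ → 0#) → ∀ l → x l ≈ 0#
          indep′ x x≈0 = indep x λ f → begin
            combination x v f                       ≈⟨ embed-path (combination x v) f ⟨
            embed (combination x v) (path f)        ≈⟨ embed-combination x (path f) ⟨
            combination x (embed ∘ v) (path f)      ≈⟨ x-0≈x _ ⟨
            combination x (embed ∘ v) (path f) - 0#
              ≈⟨ I⇒vanishes x≈0 (path f)
                   (allowed⇒regular G {i = path f} (proj₁ (Enumeration.sound enumerateThrough f))) ⟩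
            0#                                      ∎

          span′ : ∀ u → Ω₃ K n G a b u → ∃[ x ] _≈ᴿ_ K n u (lincomb K n x (embed ∘ v))
          span′ u u∈ with span (u ∘ path) (Ω₃⇒conserved u∈)
          ... | x , eq = x , vanishes⇒I λ i reg → x≈y⇒x-y≈0 (begin
            u i                           ≈⟨ Ω₃⇒embed u∈ i reg ⟩
            embed (u ∘ path) i            ≈⟨ ⟨⟩-cong {k} {w = λ f → e K n (path f) i} eq (λ _ → refl) ⟩
            embed (combination x v) i     ≈⟨ embed-combination x i ⟨
            combination x (embed ∘ v) i   ∎)

-- Subsets of a finite set

-- Each instance of excluded middle is irrefutable, and double negation commutes with finite
-- conjunctions.
¬¬-decidable : ∀ {n p} (P : Pred (Fin n) p) → ¬ ¬ Decidable P
¬¬-decidable {zero}  P ¬P? = ¬P? λ ()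
¬¬-decidable {suc n} P ¬P? = ¬¬-decidable (P ∘ suc) λ P? →
  ¬P? λ { zero → no (λ P₀ → ¬P? λ { zero → yes P₀ ; (suc i) → P? i }) ; (suc i) → P? i }

module _ {n : ℕ} where

  ∈-tabulate⁺ : ∀ {p} {P : Pred (Fin n) p} (P? : Decidable P) {x} → P x → x ∈ tabulate (does ∘ P?)
  ∈-tabulate⁺ P? {x} Px = lookup⇒[]= x _ (≡.trans (lookup∘tabulate (does ∘ P?) x) (dec-true (P? x) Px))

  ∈-tabulate⁻ : ∀ {p} {P : Pred (Fin n) p} (P? : Decidable P) {x} → x ∈ tabulate (does ∘ P?) → P x
  ∈-tabulate⁻ P? {x} x∈ with P? x | ≡.trans (≡.sym (lookup∘tabulate (does ∘ P?) x)) ([]=⇒lookup x∈)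
  ... | yes Px | _ = Px

x∈p─q⇒x∉q : ∀ {n} {p q : Subset n} {x} → x ∈ p ─ q → x ∉ q
x∈p─q⇒x∉q {p = _ ∷ p} {inside ∷ q}  (there x∈) (there x∈q) = x∈p─q⇒x∉q {p = p} {q} x∈ x∈q
x∈p─q⇒x∉q {p = _ ∷ p} {outside ∷ q} (there x∈) (there x∈q) = x∈p─q⇒x∉q {p = p} {q} x∈ x∈q

nth : ∀ {n} (p : Subset n) → Fin ∣ p ∣ → Fin n
nth (inside  ∷ p) zero    = zero
nth (inside  ∷ p) (suc k) = suc (nth p k)
nth (outside ∷ p) k       = suc (nth p k)

enumerateSubset : ∀ {n} (p : Subset n) → Enumeration (_∈ p)
enumerateSubset p = record
  { size = ∣ p ∣ ; at = nth p ; sound = sound p ; complete = complete p ; injective = injective p }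
  where
  sound : ∀ {n} (p : Subset n) k → nth p k ∈ p
  sound (inside  ∷ p) zero    = here
  sound (inside  ∷ p) (suc k) = there (sound p k)
  sound (outside ∷ p) k       = there (sound p k)

  complete : ∀ {n} (p : Subset n) {x} → x ∈ p → ∃[ k ] nth p k ≡ x
  complete (inside ∷ p)  here = zero , ≡.refl
  complete (inside ∷ p)  (there x∈p) with complete p x∈p
  ... | k , eq = suc k , ≡.cong suc eq
  complete (outside ∷ p) (there x∈p) with complete p x∈p
  ... | k , eq = k , ≡.cong suc eq

  injective : ∀ {n} (p : Subset n) → Injective _≡_ _≡_ (nth p)
  injective (inside  ∷ p) {zero}  {zero}  eq = ≡.refl
  injective (inside  ∷ p) {suc _} {suc _} eq = ≡.cong suc (injective p (suc-injective eq))
  injective (outside ∷ p) eq = injective p (suc-injective eq)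

-- Collapse of the complement of a subset to one point, zero

module Collapse {n : ℕ} (p : Subset n) where
  open Enumeration (enumerateSubset p)

  collapse : Fin n → Fin (suc ∣ p ∣)
  collapse x with x ∈? p
  ... | yes x∈p = suc (proj₁ (complete x∈p))
  ... | no _    = zero

  collapse-∉ : ∀ {x} → x ∉ p → collapse x ≡ zero
  collapse-∉ {x} x∉p with x ∈? p
  ... | yes x∈p = contradiction x∈p x∉p
  ... | no _    = ≡.refl

  collapse-nth : ∀ k → collapse (nth p k) ≡ suc k
  collapse-nth k with nth p k ∈? p
  ... | yes x∈p = ≡.cong suc (injective (proj₂ (complete x∈p)))
  ... | no x∉p  = contradiction (sound k) x∉p

  collapse-∈ : ∀ {x} → x ∈ p → ∃[ k ] nth p k ≡ x × collapse x ≡ suc k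
  collapse-∈ x∈p with complete x∈p
  ... | k , ≡.refl = k , ≡.refl , collapse-nth k

  -- The fibre over each `suc k` is a single vertex. Assuming membership of `y` alone lets `x` be an
  -- arbitrary end of an edge.
  collapse-injective : ∀ {x y} → y ∈ p → collapse x ≡ collapse y → x ≡ y
  collapse-injective {x} y∈p eq with collapse-∈ y∈p | x ∈? p
  ... | k , ≡.refl , eqₖ | yes x∈p =
    ≡.trans (≡.sym (proj₂ (complete x∈p))) (≡.cong (nth p) (suc-injective (≡.trans eq eqₖ)))
  ... | k , ≡.refl , eqₖ | no x∉p with () ← ≡.trans eq eqₖ

-- Counting

open MonoidSum ℕ.+-0-commutativeMonoid using ()
  renaming (sum to sumℕ; sum-cong-≗ to sumℕ-cong; ∑-distrib-+ to sumℕ-distrib-+; sum-replicate-zero to sumℕ-zero)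
open MonoidSum ℤ.+-0-commutativeMonoid using () renaming (sum to sumℤ)

⟦_⟧ : ∀ {p} {P : Set p} → Dec P → ℕ
⟦ yes _ ⟧ = 1
⟦ no _ ⟧  = 0

⟦⟧-true : ∀ {p} {P : Set p} (P? : Dec P) → P → ⟦ P? ⟧ ≡ 1
⟦⟧-true (yes _) _ = ≡.refl
⟦⟧-true (no ¬x) x = contradiction x ¬x

⟦⟧-false : ∀ {p} {P : Set p} (P? : Dec P) → ¬ P → ⟦ P? ⟧ ≡ 0
⟦⟧-false (yes x) ¬x = contradiction x ¬x
⟦⟧-false (no _)  _  = ≡.refl

sumℕ-single : ∀ {m} (f : Vector ℕ m) i → (∀ j → j ≢ i → f j ≡ 0) → sumℕ f ≡ f i
sumℕ-single {suc m} f zero f≡0 = ≡.trans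
  (≡.cong (f zero ℕ.+_) (≡.trans (sumℕ-cong λ j → f≡0 (suc j) λ ()) (sumℕ-zero m)))
  (ℕ.+-identityʳ _)
sumℕ-single f (suc i) f≡0 =
  ≡.cong₂ ℕ._+_ (f≡0 zero λ ()) (sumℕ-single (f ∘ suc) i λ j j≢i → f≡0 (suc j) (j≢i ∘ suc-injective))

module _ {a} {A : Set a} where

  length-filter-∷ : ∀ {p} {P : Pred A p} (P? : Decidable P) x xs →
    length (filter P? (x List.∷ xs)) ≡ ⟦ P? x ⟧ ℕ.+ length (filter P? xs)
  length-filter-∷ P? x xs with P? x
  ... | yes _ = ≡.refl
  ... | no _  = ≡.refl

  length-filter-partition : ∀ {p q m} {P : Pred A p} {Q : Fin m → Pred A q}
    (P? : Decidable P) (Q? : ∀ i → Decidable (Q i)) xs →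
    (∀ {x} → x ∈ˡ xs → P x → ∃[ i ] Q i x × (∀ j → Q j x → j ≡ i)) →
    (∀ {x} → x ∈ˡ xs → ∀ i → Q i x → P x) →
    length (filter P? xs) ≡ sumℕ λ i → length (filter (Q? i) xs)
  length-filter-partition {m = m} P? Q? List.[] _ _ = ≡.sym (sumℕ-zero m)
  length-filter-partition {m = m} {P} {Q} P? Q? (x List.∷ xs) split join = begin
    length (filter P? (x List.∷ xs))
      ≡⟨ length-filter-∷ P? x xs ⟩
    ⟦ P? x ⟧ ℕ.+ length (filter P? xs)
      ≡⟨ ≡.cong₂ ℕ._+_ (pointwise (P? x)) (length-filter-partition P? Q? xs (split ∘ there) (join ∘ there)) ⟩
    sumℕ (λ i → ⟦ Q? i x ⟧) ℕ.+ sumℕ (λ i → length (filter (Q? i) xs))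
      ≡⟨ sumℕ-distrib-+ (λ i → ⟦ Q? i x ⟧) _ ⟨
    sumℕ (λ i → ⟦ Q? i x ⟧ ℕ.+ length (filter (Q? i) xs))
      ≡⟨ sumℕ-cong (λ i → length-filter-∷ (Q? i) x xs) ⟨
    sumℕ (λ i → length (filter (Q? i) (x List.∷ xs)))
      ∎
    where
    open ≡.≡-Reasoning
    pointwise : (Px? : Dec (P x)) → ⟦ Px? ⟧ ≡ sumℕ λ i → ⟦ Q? i x ⟧
    pointwise (no ¬Px) = ≡.sym (≡.trans (sumℕ-cong λ i → ⟦⟧-false (Q? i x) (¬Px ∘ join (here ≡.refl) i)) (sumℕ-zero m))
    pointwise (yes Px) with split (here ≡.refl) Px
    ... | i , Qix , unique = ≡.sym (≡.trans
      (sumℕ-single (λ j → ⟦ Q? j x ⟧) i λ j j≢i → ⟦⟧-false (Q? j x) (j≢i ∘ unique j))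
      (⟦⟧-true (Q? i x) Qix))

  length≢0 : ∀ {xs : List A} → length xs ≢ 0 → ∃[ x ] x ∈ˡ xs
  length≢0 {List.[]}     len≢0 = contradiction ≡.refl len≢0
  length≢0 {x List.∷ xs} _     = x , here ≡.refl

  ∈⇒length≢0 : ∀ {x} {xs : List A} → x ∈ˡ xs → length xs ≢ 0
  ∈⇒length≢0 {xs = _ List.∷ _} _ ()

zeros : ∀ {m} → Vector ℕ m → Subset m
zeros f = tabulate λ k → does (f k ℕ.≟ 0)

-- Termwise this is max(0, r - 1) + 1 = r + [r = 0]. It trades the truncated sum for the number of
-- empty `S_k`.
sum-predecessors : ∀ {m} (f : Vector ℕ m) →
  sumℤ (λ k → 0ℤ ℤ.⊔ (+ f k ℤ.- 1ℤ)) ℤ.+ + m ≡ + (sumℕ f ℕ.+ ∣ zeros f ∣)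
sum-predecessors {zero}  f = ≡.refl
sum-predecessors {suc m} f with f zero | sum-predecessors (f ∘ suc)
... | zero  | eq = begin
  0ℤ ℤ.+ M ℤ.+ + suc m                          ≡⟨ solve 2 (λ x y → con 0ℤ :+ x :+ (con 1ℤ :+ y) := con 1ℤ :+ (x :+ y))
                                                       ≡.refl M (+ m) ⟩
  1ℤ ℤ.+ (M ℤ.+ + m)                            ≡⟨ ≡.cong (λ x → 1ℤ ℤ.+ x) eq ⟩
  + suc (sumℕ (f ∘ suc) ℕ.+ ∣ zeros (f ∘ suc) ∣)  ≡⟨ ≡.cong (+_) (ℕ.+-suc _ _) ⟨
  + (sumℕ (f ∘ suc) ℕ.+ suc ∣ zeros (f ∘ suc) ∣)  ∎
  where
  open ≡.≡-Reasoning
  open +-*-Solver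
  M = sumℤ (λ k → 0ℤ ℤ.⊔ (+ f (suc k) ℤ.- 1ℤ))
... | suc r | eq = begin
  + r ℤ.+ M ℤ.+ + suc m                         ≡⟨ solve 3 (λ x y z → x :+ y :+ (con 1ℤ :+ z) := con 1ℤ :+ x :+ (y :+ z))
                                                       ≡.refl (+ r) M (+ m) ⟩
  + suc r ℤ.+ (M ℤ.+ + m)                       ≡⟨ ≡.cong (λ x → + suc r ℤ.+ x) eq ⟩
  + (suc r ℕ.+ (sumℕ (f ∘ suc) ℕ.+ ∣ zeros (f ∘ suc) ∣)) ≡⟨ ≡.cong (+_) (ℕ.+-assoc (suc r) _ _) ⟨
  + (suc r ℕ.+ sumℕ (f ∘ suc) ℕ.+ ∣ zeros (f ∘ suc) ∣) ∎
  where
  open ≡.≡-Reasoning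
  open +-*-Solver
  M = sumℤ (λ k → 0ℤ ℤ.⊔ (+ f (suc k) ℤ.- 1ℤ))

-- The multigraph of middle edges

module Combinatorics {n ℓ} (G : Digraph n ℓ) (a b : Fin n) where
  open Digraph G

  A B L R V : Subset n
  A = A-set G a b
  B = B-set G a b
  L = N⁺ a ∩ (N⁻ b ∪ ⁅ b ⁆)
  R = (N⁺ a ∪ ⁅ a ⁆) ∩ N⁻ b
  V = (A ─ B) ∪ (B ─ A)

  H : PartialDigraph n
  H = Ind G (A ─ B) (B ─ A)

  module _ {v w : Fin n} where

    ∈N⁺⁺ : v ⟶ w → w ∈ N⁺ v
    ∈N⁺⁺ = ∈-tabulate⁺ (v ⟶?_)

    ∈N⁺⁻ : w ∈ N⁺ v → v ⟶ w
    ∈N⁺⁻ = ∈-tabulate⁻ (v ⟶?_)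

    ∈N⁻⁺ : w ⟶ v → w ∈ N⁻ v
    ∈N⁻⁺ = ∈-tabulate⁺ (_⟶? v)

    ∈N⁻⁻ : w ∈ N⁻ v → w ⟶ v
    ∈N⁻⁻ = ∈-tabulate⁻ (_⟶? v)

  ⟶⇒≢ : ∀ {v w} → v ⟶ w → v ≢ w
  ⟶⇒≢ v→w ≡.refl = loopless _ v→w

  module _ {x : Fin n} where

    x∉⁅_⁆ : ∀ y → x ≢ y → x ∉ ⁅ y ⁆
    x∉⁅ y ⁆ x≢y = x≢y ∘ x∈⁅y⁆⇒x≡y y

    ∈A⁺ : a ⟶ x → x ≢ b → x ∈ A
    ∈A⁺ a→x x≢b = x∈p∧x∉q⇒x∈p─q (∈N⁺⁺ a→x) (x∉⁅ b ⁆ x≢b)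

    ∈A⁻ : x ∈ A → a ⟶ x × x ≢ b
    ∈A⁻ x∈A = ∈N⁺⁻ (p─q⊆p (N⁺ a) ⁅ b ⁆ x∈A) , λ { ≡.refl → x∈p─q⇒x∉q {p = N⁺ a} x∈A (x∈⁅x⁆ b) }

    ∈B⁺ : x ⟶ b → x ≢ a → x ∈ B
    ∈B⁺ x→b x≢a = x∈p∧x∉q⇒x∈p─q (∈N⁻⁺ x→b) (x∉⁅ a ⁆ x≢a)

    ∈B⁻ : x ∈ B → x ⟶ b × x ≢ a
    ∈B⁻ x∈B = ∈N⁻⁻ (p─q⊆p (N⁻ b) ⁅ a ⁆ x∈B) , λ { ≡.refl → x∈p─q⇒x∉q {p = N⁻ b} x∈B (x∈⁅x⁆ a) }

    -- Elements of `A` differ from `b` by definition and from `a` by looplessness, and symmetrically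
    -- for `B`. So the vertices of `H` are exactly those at which a cancellation is required.
    V⇒Inner : x ∈ V → Inner G a b x
    V⇒Inner x∈V with x∈p∪q⁻ (A ─ B) (B ─ A) x∈V
    ... | inj₁ x∈A─B with ∈A⁻ (p─q⊆p A B x∈A─B)
    ...   | a→x , x≢b = x≢a , x≢b , (λ (_ , x→b) → x∈p─q⇒x∉q {p = A} x∈A─B (∈B⁺ x→b x≢a)) , inj₁ a→x
      where x≢a = ⟶⇒≢ a→x ∘ ≡.sym
    V⇒Inner x∈V | inj₂ x∈B─A with ∈B⁻ (p─q⊆p B A x∈B─A)
    ...   | x→b , x≢a = x≢a , ⟶⇒≢ x→b , (λ (a→x , _) → x∈p─q⇒x∉q {p = B} x∈B─A (∈A⁺ a→x (⟶⇒≢ x→b))) , inj₂ x→b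

    -- No vertex of `V` is both an out-neighbour of `a` and an in-neighbour of `b`, so its role in a
    -- middle edge fixes its side. Hence the middle edges inside `V` are exactly the edges of `H`.
    source-V : a ⟶ x → x ∈ V → x ∈ A ─ B
    source-V a→x x∈V with V⇒Inner x∈V
    ... | x≢a , x≢b , ¬axb , _ = x∈p∧x∉q⇒x∈p─q (∈A⁺ a→x x≢b) (λ x∈B → ¬axb (a→x , proj₁ (∈B⁻ x∈B)))

    target-V : x ⟶ b → x ∈ V → x ∈ B ─ A
    target-V x→b x∈V with V⇒Inner x∈V
    ... | x≢a , x≢b , ¬axb , _ = x∈p∧x∉q⇒x∈p─q (∈B⁺ x→b x≢a) (λ x∈A → ¬axb (proj₁ (∈A⁻ x∈A) , x→b))

    Inner⇒V : Inner G a b x → x ∈ V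
    Inner⇒V (x≢a , x≢b , ¬axb , inj₁ a→x) = x∈p∪q⁺ (inj₁ (x∈p∧x∉q⇒x∈p─q
      (∈A⁺ a→x x≢b) (λ x∈B → ¬axb (a→x , proj₁ (∈B⁻ x∈B)))))
    Inner⇒V (x≢a , x≢b , ¬axb , inj₂ x→b) = x∈p∪q⁺ (inj₂ (x∈p∧x∉q⇒x∈p─q
      (∈B⁺ x→b x≢a) (λ x∈A → ¬axb (proj₁ (∈A⁻ x∈A) , x→b))))

    ∈A─B⇒source : x ∈ A ─ B → a ⟶ x × x ∈ V
    ∈A─B⇒source x∈ = proj₁ (∈A⁻ (p─q⊆p A B x∈)) , x∈p∪q⁺ (inj₁ x∈)

    ∈B─A⇒target : x ∈ B ─ A → x ⟶ b × x ∈ V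
    ∈B─A⇒target x∈ = proj₁ (∈B⁻ (p─q⊆p B A x∈)) , x∈p∪q⁺ (inj₂ x∈)

    -- `L` turns out to be the set of sources that collapse to the ground vertex, among them `b` if
    -- `a ⟶ b`; likewise `R` for targets, with `a`.
    ∈L⁻ : x ∈ L → a ⟶ x × x ∉ V
    ∈L⁻ x∈L with x∈p∩q⁻ (N⁺ a) (N⁻ b ∪ ⁅ b ⁆) x∈L
    ... | x∈N⁺ , x∈∪ = ∈N⁺⁻ x∈N⁺ , λ x∈V → let (_ , x≢b , ¬axb , _) = V⇒Inner x∈V in
      [ (λ x∈N⁻ → ¬axb (∈N⁺⁻ x∈N⁺ , ∈N⁻⁻ x∈N⁻)) , x∉⁅ b ⁆ x≢b ]′ (x∈p∪q⁻ (N⁻ b) ⁅ b ⁆ x∈∪)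

    ∈L⁺ : a ⟶ x → x ∉ V → x ∈ L
    ∈L⁺ a→x x∉V with x ≟ b | x ⟶? b
    ... | yes ≡.refl | _       = x∈p∩q⁺ (∈N⁺⁺ a→x , x∈p∪q⁺ (inj₂ (x∈⁅x⁆ b)))
    ... | no _       | yes x→b = x∈p∩q⁺ (∈N⁺⁺ a→x , x∈p∪q⁺ (inj₁ (∈N⁻⁺ x→b)))
    ... | no x≢b     | no ¬x→b = contradiction (Inner⇒V (⟶⇒≢ a→x ∘ ≡.sym , x≢b , ¬x→b ∘ proj₂ , inj₁ a→x)) x∉V

    ∈R⁻ : x ∈ R → x ⟶ b × x ∉ V
    ∈R⁻ x∈R with x∈p∩q⁻ (N⁺ a ∪ ⁅ a ⁆) (N⁻ b) x∈R
    ... | x∈∪ , x∈N⁻ = ∈N⁻⁻ x∈N⁻ , λ x∈V → let (x≢a , _ , ¬axb , _) = V⇒Inner x∈V in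
      [ (λ x∈N⁺ → ¬axb (∈N⁺⁻ x∈N⁺ , ∈N⁻⁻ x∈N⁻)) , x∉⁅ a ⁆ x≢a ]′ (x∈p∪q⁻ (N⁺ a) ⁅ a ⁆ x∈∪)

    ∈R⁺ : x ⟶ b → x ∉ V → x ∈ R
    ∈R⁺ x→b x∉V with x ≟ a | a ⟶? x
    ... | yes ≡.refl | _       = x∈p∩q⁺ (x∈p∪q⁺ (inj₂ (x∈⁅x⁆ a)) , ∈N⁻⁺ x→b)
    ... | no _       | yes a→x = x∈p∩q⁺ (x∈p∪q⁺ (inj₁ (∈N⁺⁺ a→x)) , ∈N⁻⁺ x→b)
    ... | no x≢a     | no ¬a→x = contradiction (Inner⇒V (x≢a , ⟶⇒≢ x→b , ¬a→x ∘ proj₁ , inj₂ x→b)) x∉V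

  module _ {u v : Fin n} where

    ∈edges⁺ : u ⟶ v → (u , v) ∈ˡ edges
    ∈edges⁺ = ∈-filter⁺ (uncurry _⟶?_) (∈-cartesianProduct⁺ (∈-allFin u) (∈-allFin v))

    ∈edges⁻ : (u , v) ∈ˡ edges → u ⟶ v
    ∈edges⁻ = proj₂ ∘ ∈-filter⁻ (uncurry _⟶?_) {xs = cartesianProduct (allFin n) (allFin n)}

  module _ {X Y : Subset n} {u v : Fin n} where

    ∈E⁺ : u ⟶ v → u ∈ X → v ∈ Y → (u , v) ∈ˡ E X Y
    ∈E⁺ u→v u∈X v∈Y = ∈-filter⁺ (λ (u , v) → u ∈? X ×-dec v ∈? Y) (∈edges⁺ u→v) (u∈X , v∈Y)

    ∈E⁻ : (u , v) ∈ˡ E X Y → u ⟶ v × u ∈ X × v ∈ Y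
    ∈E⁻ uv∈ with ∈-filter⁻ (λ (u , v) → u ∈? X ×-dec v ∈? Y) {xs = edges} uv∈
    ... | uv∈edges , u∈X , v∈Y = ∈edges⁻ uv∈edges , u∈X , v∈Y

  E-unique : ∀ X Y → Unique (E X Y)
  E-unique X Y = filter⁺ (λ (u , v) → u ∈? X ×-dec v ∈? Y)
    (filter⁺ (uncurry _⟶?_) (cartesianProduct⁺ (allFin⁺ n) (allFin⁺ n)))

  open Enumeration (enumerateList (E-unique (N⁺ a) (N⁻ b))) public

  src tgt : Fin size → Fin n
  src e = proj₁ (at e)
  tgt e = proj₂ (at e)

  src-tgt-sound : ∀ e → a ⟶ src e × src e ⟶ tgt e × tgt e ⟶ b
  src-tgt-sound e with ∈E⁻ (sound e)
  ... | s→t , s∈ , t∈ = ∈N⁺⁻ s∈ , s→t , ∈N⁻⁻ t∈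

  src-tgt-complete : ∀ {i j} → a ⟶ i → i ⟶ j → j ⟶ b → ∃[ e ] src e ≡ i × tgt e ≡ j
  src-tgt-complete a→i i→j j→b with complete (∈E⁺ i→j (∈N⁺⁺ a→i) (∈N⁻⁺ j→b))
  ... | e , eq = e , ≡.cong proj₁ eq , ≡.cong proj₂ eq

  src-tgt-injective : ∀ {e f} → src e ≡ src f → tgt e ≡ tgt f → e ≡ f
  src-tgt-injective eq eq′ = injective (≡.cong₂ _,_ eq eq′)

  open Collapse V public

  -- Components of `H` and classes of the multigraph

  module Components {t} {Hs : Fin t → Subset n} (components : ListsComponents H Hs) where
    open ListsComponents components renaming (injective to Hs-injective)

    Sₖ : Fin t → List (Fin n × Fin n)
    Sₖ k = S G a b (Hs k)

    root : Fin t → Fin n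
    root k = proj₁ (isComponent k)

    connected-root : ∀ {k x} → x ∈ Hs k → x ∈ V × Connected H (root k) x
    connected-root {k} = to (proj₂ (proj₂ (isComponent k)) _)

    connected-∈ : ∀ {k x y} → x ∈ Hs k → y ∈ V → Connected H x y → y ∈ Hs k
    connected-∈ {k} x∈ y∈V x~y = from (proj₂ (proj₂ (isComponent k)) _)
      (y∈V , EqClosure.transitive _ (proj₂ (connected-root x∈)) x~y)

    root-∈ : ∀ k → root k ∈ Hs k
    root-∈ k = from (proj₂ (proj₂ (isComponent k)) _) (proj₁ (proj₂ (isComponent k)) , EqClosure.reflexive _)

    same-component : ∀ {k x y} → x ∈ Hs k → y ∈ Hs k → Connected H x y
    same-component x∈ y∈ = EqClosure.transitive _
      (EqClosure.symmetric _ (proj₂ (connected-root x∈))) (proj₂ (connected-root y∈))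

    component-unique : ∀ {k l x} → x ∈ Hs k → x ∈ Hs l → k ≡ l
    component-unique x∈k x∈l = Hs-injective (⊆-antisym
      (λ y∈ → connected-∈ x∈l (proj₁ (connected-root y∈)) (same-component x∈k y∈))
      (λ y∈ → connected-∈ x∈k (proj₁ (connected-root y∈)) (same-component x∈l y∈)))

    -- Connectedness is not known to be decidable here, but membership in the listed
    -- components is, so it may be decided under a double negation.
    component : ∀ {x} → x ∈ V → ∃[ k ] x ∈ Hs k
    component {x} x∈V with any? (λ k → x ∈? Hs k)
    ... | yes k∈ = k∈
    ... | no  ∄k = contradiction (λ P? → ∄k (witness P?)) (¬¬-decidable P)
      where
      P : Pred (Fin n) _
      P w = w ∈ V × Connected H x w
      witness : Decidable P → ∃[ k ] x ∈ Hs k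
      witness P? with exhaustive (tabulate (does ∘ P?)) (x , x∈V , λ w → mk⇔ (∈-tabulate⁻ P?) (∈-tabulate⁺ P?))
      ... | k , eq = k , ≡.subst (x ∈_) (≡.sym eq) (∈-tabulate⁺ P? (x∈V , EqClosure.reflexive _))

    Joins : Fin t → Fin n × Fin n → Set
    Joins k (u , v) = (u ∈ Hs k ─ B × v ∈ R) ⊎ (u ∈ L × v ∈ Hs k ─ A)

    -- Spelled like the filter in `S`, so that `Sₖ k` is definitionally `filter (Joins? k) edges`.
    Joins? : ∀ k → Decidable (Joins k)
    Joins? k = λ (u , v) → (u ∈? (Hs k ─ B) ×-dec v ∈? R) ⊎-dec (u ∈? L ×-dec v ∈? (Hs k ─ A))

    -- A source in `V` lies outside `B` and a target in `V` outside `A`, so the differences in `S_k`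
    -- lose no edge between `H_k` and the ground.
    Joins⁺ : ∀ {k u v} → a ⟶ u → v ⟶ b → (u ∈ Hs k × v ∉ V) ⊎ (u ∉ V × v ∈ Hs k) → Joins k (u , v)
    Joins⁺ a→u v→b (inj₁ (u∈ , v∉V)) = inj₁
      ( x∈p∧x∉q⇒x∈p─q u∈ (x∈p─q⇒x∉q {p = A} (source-V a→u (proj₁ (connected-root u∈))))
      , ∈R⁺ v→b v∉V )
    Joins⁺ a→u v→b (inj₂ (u∉V , v∈)) = inj₂
      ( ∈L⁺ a→u u∉V
      , x∈p∧x∉q⇒x∈p─q v∈ (x∈p─q⇒x∉q {p = B} (target-V v→b (proj₁ (connected-root v∈)))) )

    -- Conversely, the differences force the end in `H_k` onto the correct side, which supplies the
    -- missing edge from `a` or to `b`.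
    Joins⁻ : ∀ {k u v} → Joins k (u , v) → a ⟶ u × v ⟶ b × ((u ∈ Hs k × v ∉ V) ⊎ (u ∉ V × v ∈ Hs k))
    Joins⁻ {k} {u} {v} (inj₁ (u∈ , v∈R)) with ∈R⁻ v∈R
    ... | v→b , v∉V = a→u , v→b , inj₁ (u∈Hs , v∉V)
      where
      u∈Hs = p─q⊆p (Hs k) B u∈
      a→u : a ⟶ u
      a→u with x∈p∪q⁻ (A ─ B) (B ─ A) (proj₁ (connected-root u∈Hs))
      ... | inj₁ u∈A─B = proj₁ (∈A─B⇒source u∈A─B)
      ... | inj₂ u∈B─A = contradiction (p─q⊆p B A u∈B─A) (x∈p─q⇒x∉q {p = Hs k} u∈)
    Joins⁻ {k} {u} {v} (inj₂ (u∈L , v∈)) with ∈L⁻ u∈L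
    ... | a→u , u∉V = a→u , v→b , inj₂ (u∉V , v∈Hs)
      where
      v∈Hs = p─q⊆p (Hs k) A v∈
      v→b : v ⟶ b
      v→b with x∈p∪q⁻ (A ─ B) (B ─ A) (proj₁ (connected-root v∈Hs))
      ... | inj₂ v∈B─A = proj₁ (∈B─A⇒target v∈B─A)
      ... | inj₁ v∈A─B = contradiction (p─q⊆p A B v∈A─B) (x∈p─q⇒x∉q {p = Hs k} v∈)

    -- Middle edges are sorted by their ends in `V`: both (an edge of `H`), none (from `L` to `R`),
    -- or exactly one, whose component is the unique `k` with the edge in `S_k`.
    count-middle-edges : size ≡
      length (PartialDigraph.edgeList H) ℕ.+ (length (E L R) ℕ.+ sumℕ λ k → length (Sₖ k))
    count-middle-edges = length-filter-partition (λ (u , v) → u ∈? N⁺ a ×-dec v ∈? N⁻ b) Q? edges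
      (λ {x} x∈ (u∈ , v∈) → split (∈edges⁻ x∈) (∈N⁺⁻ u∈) (∈N⁻⁻ v∈))
      (λ {x} x∈ i → join i)
      where
      Q : Fin (suc (suc t)) → Pred (Fin n × Fin n) _
      Q zero          (u , v) = u ∈ A ─ B × v ∈ B ─ A
      Q (suc zero)    (u , v) = u ∈ L × v ∈ R
      Q (suc (suc k))         = Joins k

      Q? : ∀ i → Decidable (Q i)
      Q? zero          (u , v) = u ∈? (A ─ B) ×-dec v ∈? (B ─ A)
      Q? (suc zero)    (u , v) = u ∈? L ×-dec v ∈? R
      Q? (suc (suc k))         = Joins? k

      join : ∀ {u v} i → Q i (u , v) → u ∈ N⁺ a × v ∈ N⁻ b
      join zero          (u∈ , v∈) = ∈N⁺⁺ (proj₁ (∈A─B⇒source u∈)) , ∈N⁻⁺ (proj₁ (∈B─A⇒target v∈))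
      join (suc zero)    (u∈ , v∈) = ∈N⁺⁺ (proj₁ (∈L⁻ u∈)) , ∈N⁻⁺ (proj₁ (∈R⁻ v∈))
      join (suc (suc k)) uv∈ with Joins⁻ uv∈
      ... | a→u , v→b , _ = ∈N⁺⁺ a→u , ∈N⁻⁺ v→b

      split : ∀ {u v} → u ⟶ v → a ⟶ u → v ⟶ b → ∃[ i ] Q i (u , v) × (∀ j → Q j (u , v) → j ≡ i)
      split {u} {v} u→v a→u v→b with u ∈? V | v ∈? V
      ... | yes u∈V | yes v∈V = zero , (source-V a→u u∈V , target-V v→b v∈V) , λ
        { zero _ → ≡.refl
        ; (suc zero) (u∈L , _) → contradiction u∈V (proj₂ (∈L⁻ u∈L))
        ; (suc (suc k)) uv∈ → [ (λ (_ , v∉V) → contradiction v∈V v∉V)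
            , (λ (u∉V , _) → contradiction u∈V u∉V)
            ]′ (proj₂ (proj₂ (Joins⁻ uv∈))) }
      ... | no u∉V | no v∉V = suc zero , (∈L⁺ a→u u∉V , ∈R⁺ v→b v∉V) , λ
        { zero (u∈ , _) → contradiction (proj₂ (∈A─B⇒source u∈)) u∉V
        ; (suc zero) _ → ≡.refl
        ; (suc (suc k)) uv∈ → [ (λ (u∈ , _) → contradiction (proj₁ (connected-root u∈)) u∉V)
            , (λ (_ , v∈) → contradiction (proj₁ (connected-root v∈)) v∉V)
            ]′ (proj₂ (proj₂ (Joins⁻ uv∈))) }
      ... | yes u∈V | no v∉V with component u∈V
      ...   | k , u∈ = suc (suc k) , Joins⁺ a→u v→b (inj₁ (u∈ , v∉V)) , λ
        { zero (_ , v∈) → contradiction (proj₂ (∈B─A⇒target v∈)) v∉V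
        ; (suc zero) (u∈L , _) → contradiction u∈V (proj₂ (∈L⁻ u∈L))
        ; (suc (suc l)) uv∈ → [ (λ (u∈′ , _) → ≡.cong (λ i → Fin.suc (Fin.suc i)) (component-unique u∈′ u∈))
            , (λ (u∉V , _) → contradiction u∈V u∉V)
            ]′ (proj₂ (proj₂ (Joins⁻ uv∈))) }
      split {u} {v} u→v a→u v→b | no u∉V | yes v∈V with component v∈V
      ...   | k , v∈ = suc (suc k) , Joins⁺ a→u v→b (inj₂ (u∉V , v∈)) , λ
        { zero (u∈ , _) → contradiction (proj₂ (∈A─B⇒source u∈)) u∉V
        ; (suc zero) (_ , v∈R) → contradiction v∈V (proj₂ (∈R⁻ v∈R))
        ; (suc (suc l)) uv∈ → [ (λ (_ , v∉V) → contradiction v∈V v∉V)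
            , (λ (_ , v∈′) → ≡.cong (λ i → Fin.suc (Fin.suc i)) (component-unique v∈′ v∈))
            ]′ (proj₂ (proj₂ (Joins⁻ uv∈))) }

    -- The components not joined to the ground vertex.
    free : Subset t
    free = zeros (length ∘ Sₖ)

    joined : ∀ {k u v} → a ⟶ u → u ⟶ v → v ⟶ b → (u ∈ Hs k × v ∉ V) ⊎ (u ∉ V × v ∈ Hs k) → k ∉ free
    joined {k} a→u u→v v→b uv k∈ = ∈⇒length≢0
      (∈-filter⁺ (Joins? k) (∈edges⁺ u→v) (Joins⁺ a→u v→b uv))
      (∈-tabulate⁻ (λ k → length (Sₖ k) ℕ.≟ 0) k∈)

    join-edge : ∀ {k} → k ∉ free → ∃[ e ] ((src e ∈ Hs k × tgt e ∉ V) ⊎ (src e ∉ V × tgt e ∈ Hs k))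
    join-edge {k} k∉ with length≢0 {xs = Sₖ k} (k∉ ∘ ∈-tabulate⁺ (λ k → length (Sₖ k) ℕ.≟ 0))
    ... | (u , v) , uv∈ with ∈-filter⁻ (Joins? k) {xs = edges} uv∈
    ...   | uv∈edges , uv∈S with Joins⁻ uv∈S | ∈edges⁻ uv∈edges
    ...     | a→u , v→b , uv | u→v with src-tgt-complete a→u u→v v→b
    ...       | e , ≡.refl , ≡.refl = e , uv

    open Collapse free using ()
      renaming (collapse to collapseFree; collapse-∉ to collapseFree-∉; collapse-nth to collapseFree-nth)

    class : Fin n → Fin (suc ∣ free ∣)
    class x with x ∈? V
    ... | yes x∈V = collapseFree (proj₁ (component x∈V))
    ... | no  _   = zero

    class-∈ : ∀ {k x} → x ∈ Hs k → class x ≡ collapseFree k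
    class-∈ {k} {x} x∈ with x ∈? V
    ... | yes x∈V = ≡.cong collapseFree (component-unique (proj₂ (component x∈V)) x∈)
    ... | no  x∉V = contradiction (proj₁ (connected-root x∈)) x∉V

    class-edge : ∀ e → class (src e) ≡ class (tgt e)
    class-edge e with src-tgt-sound e
    ... | a→s , s→t , t→b with src e ∈? V | tgt e ∈? V
    ...   | no s∉V  | no t∉V  = ≡.refl
    ...   | yes s∈V | no t∉V  = collapseFree-∉ (joined a→s s→t t→b (inj₁ (proj₂ (component s∈V) , t∉V)))
    ...   | no s∉V  | yes t∈V = ≡.sym (collapseFree-∉ (joined a→s s→t t→b (inj₂ (s∉V , proj₂ (component t∈V)))))
    ...   | yes s∈V | yes t∈V = ≡.cong collapseFree (component-unique
              (connected-∈ (proj₂ (component s∈V)) t∈V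
                (EqClosure.return (∈E⁺ s→t (source-V a→s s∈V) (target-V t→b t∈V))))
              (proj₂ (component t∈V)))

    -- The class `zero` consists of the ground vertex and all components outside `free`; each free
    -- component is a class of its own, represented by its root.
    coequalizer : Coequalizer (collapse ∘ src) (collapse ∘ tgt) (suc ∣ free ∣)
    coequalizer = record
      { quot      = quot
      ; rep       = rep
      ; quot-rep  = quot-rep
      ; equalizes = λ e → ≡.trans (quot-collapse (src e)) (≡.trans (class-edge e) (≡.sym (quot-collapse (tgt e))))
      ; universal = universal
      }
      where
      quot : Fin (suc ∣ V ∣) → Fin (suc ∣ free ∣)
      quot zero    = zero
      quot (suc i) = class (nth V i)

      rep : Fin (suc ∣ free ∣) → Fin (suc ∣ V ∣)
      rep zero    = zero
      rep (suc l) = collapse (root (nth free l))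

      quot-collapse : ∀ x → quot (collapse x) ≡ class x
      quot-collapse x with x ∈? V
      ... | no x∉V  = ≡.refl
      ... | yes x∈V = ≡.trans
        (≡.cong class (proj₂ (Enumeration.complete (enumerateSubset V) x∈V)))
        (class-∈ (proj₂ (component x∈V)))

      quot-rep : ∀ l → quot (rep l) ≡ l
      quot-rep zero    = ≡.refl
      quot-rep (suc l) = ≡.trans (quot-collapse (root (nth free l)))
        (≡.trans (class-∈ (root-∈ (nth free l))) (collapseFree-nth l))

      module _ {p} (f : Fin (suc ∣ V ∣) → Fin p)
        (f-edge : ∀ e → f (collapse (src e)) ≡ f (collapse (tgt e))) where

        -- Every edge of `H` is among the enumerated edges, so `f` is constant along it.
        f-connected : ∀ {x y} → Connected H x y → f (collapse x) ≡ f (collapse y)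
        f-connected = EqClosure.gfold ≡.isEquivalence (f ∘ collapse) step
          where
          step : ∀ {x y} → (x , y) ∈ˡ E (A ─ B) (B ─ A) → f (collapse x) ≡ f (collapse y)
          step xy∈ with ∈E⁻ xy∈
          ... | x→y , x∈ , y∈ with src-tgt-complete (proj₁ (∈A─B⇒source x∈)) x→y (proj₁ (∈B─A⇒target y∈))
          ...   | e , ≡.refl , ≡.refl = f-edge e

        f-joined : ∀ {k x} → x ∈ Hs k → k ∉ free → f zero ≡ f (collapse x)
        f-joined x∈ k∉ with join-edge k∉
        ... | e , inj₁ (s∈ , t∉V) = ≡.trans (≡.cong f (≡.sym (collapse-∉ t∉V)))
          (≡.trans (≡.sym (f-edge e)) (f-connected (same-component s∈ x∈)))
        ... | e , inj₂ (s∉V , t∈) = ≡.trans (≡.cong f (≡.sym (collapse-∉ s∉V)))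
          (≡.trans (f-edge e) (f-connected (same-component t∈ x∈)))

        f-class : ∀ {k x} → x ∈ Hs k → f (rep (collapseFree k)) ≡ f (collapse x)
        f-class {k} x∈ with k ∈? free
        ... | no k∉  = f-joined x∈ k∉
        ... | yes k∈ with Enumeration.complete (enumerateSubset free) k∈
        ...   | l , ≡.refl = f-connected (same-component (root-∈ (nth free l)) x∈)

        universal : ∀ y → f (rep (quot y)) ≡ f y
        universal zero    = ≡.refl
        universal (suc i) with component (Enumeration.sound (enumerateSubset V) i)
        ... | k , x∈ = ≡.trans (≡.cong (f ∘ rep) (class-∈ x∈)) (≡.trans (f-class x∈) (≡.cong f (collapse-nth i)))

-- Conserved weights as flows, and the dimension count

module _ {c ℓ₁ ℓ₂ ℓ} (K : HeytingField c ℓ₁ ℓ₂) {n : ℕ} (G : Digraph n ℓ) (a b : Fin n) where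
  open Digraph G using (E)
  open HeytingField K using (heytingCommutativeRing)
  open HeytingCommutativeRing heytingCommutativeRing using (commutativeRing)
  open CommutativeRing commutativeRing hiding (zero)
  open RingProperties ring
  open SemiringSum semiring
  open CycleSpace commutativeRing
  open Chains K n
  open Combinatorics G a b
  open import Relation.Binary.Reasoning.Setoid setoid

  private
    Conserved′ = Conserved G a b src tgt src-tgt-sound src-tgt-complete src-tgt-injective

  -- The test potential is the indicator of the collapsed `y`. As `y` lies in `V`, it is not
  -- identified with another vertex, and the indicator pulls back to that of `y`.
  flow⇒conserved : ∀ {x} → Flow (collapse ∘ src) (collapse ∘ tgt) x → Conserved′ x
  flow⇒conserved {x} x∈ y inner = trans
    (⟨⟩-cong {size} {c = x} (λ _ → refl) (λ e → +-cong (indicator (src e)) (-‿cong (indicator (tgt e)))))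
    (x∈ λ z → [ z ≟ collapse y ])
    where
    indicator : ∀ z → [ z ≟ y ] ≈ [ collapse z ≟ collapse y ]
    indicator z = []-cong (z ≟ y) (collapse z ≟ collapse y) (≡.cong collapse) (collapse-injective (Inner⇒V inner))

  -- Subtracting the value at the ground leaves potential differences unchanged. The normalised
  -- potential `ψ` vanishes outside `V`, so its expansion into indicators involves only vertices
  -- where conservation is assumed.
  conserved⇒flow : ∀ {x} → Conserved′ x → Flow (collapse ∘ src) (collapse ∘ tgt) x
  conserved⇒flow {x} x∈ φ = begin
    ⟨ x , (λ e → φ (collapse (src e)) - φ (collapse (tgt e))) ⟩
      ≈⟨ ⟨⟩-cong {size} {c = x} (λ _ → refl) (λ e → expand (src e) (tgt e)) ⟩
    combination x (λ e (_ : Fin 1) → combination (δ e) (λ y (_ : Fin 1) → ψ y) zero) zero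
      ≈⟨ combination-assoc x δ (λ y (_ : Fin 1) → ψ y) zero ⟨
    sum (λ y → combination x δ y * ψ y)
      ≈⟨ sum-zero {n = n} vanishes ⟩
    0# ∎
    where
    δ : Fin size → Vector Carrier n
    δ e y = [ src e ≟ y ] - [ tgt e ≟ y ]

    ψ : Vector Carrier n
    ψ y = φ (collapse y) - φ zero

    at-vertex : ∀ z → sum (λ y → [ z ≟ y ] * ψ y) ≈ ψ z
    at-vertex z = trans
      (sum-single (λ y → [ z ≟ y ] * ψ y) z λ y y≢z → trans (*-congʳ ([]-false (z ≟ y) (y≢z ∘ ≡.sym))) (zeroˡ _))
      (trans (*-congʳ ([]-true (z ≟ z) ≡.refl)) (*-identityˡ _))

    differences : ∀ p q r → p - q ≈ (p - r) - (q - r)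
    differences p q r = begin
      p - q             ≈⟨ +-congˡ (trans (sym (+-identityˡ _)) (+-congʳ (sym (-‿inverseˡ r)))) ⟩
      p + (- r + r - q) ≈⟨ +-congˡ (+-assoc _ _ _) ⟩
      p + (- r + (r - q)) ≈⟨ +-assoc _ _ _ ⟨
      (p - r) + (r - q) ≈⟨ +-congˡ (⁻¹-anti-homo‿- q r) ⟨
      (p - r) - (q - r) ∎

    expand : ∀ u v → φ (collapse u) - φ (collapse v) ≈ sum (λ y → ([ u ≟ y ] - [ v ≟ y ]) * ψ y)
    expand u v = begin
      φ (collapse u) - φ (collapse v)            ≈⟨ differences _ _ (φ zero) ⟩
      ψ u - ψ v                                  ≈⟨ +-cong (at-vertex u) (trans (-1*x≈-x _) (-‿cong (at-vertex v))) ⟨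
      sum (λ y → [ u ≟ y ] * ψ y) + - 1# * sum (λ y → [ v ≟ y ] * ψ y)
        ≈⟨ +-congˡ (*-distribˡ-sum (- 1#) (λ y → [ v ≟ y ] * ψ y)) ⟩
      sum (λ y → [ u ≟ y ] * ψ y) + sum (λ y → - 1# * ([ v ≟ y ] * ψ y))
        ≈⟨ ∑-distrib-+ (λ y → [ u ≟ y ] * ψ y) (λ y → - 1# * ([ v ≟ y ] * ψ y)) ⟨
      sum (λ y → [ u ≟ y ] * ψ y + - 1# * ([ v ≟ y ] * ψ y))
        ≈⟨ sum-cong {n = n} (λ y → trans (+-congˡ (-1*x≈-x _)) (sym ([y-z]x≈yx-zx (ψ y) _ _))) ⟩
      sum (λ y → ([ u ≟ y ] - [ v ≟ y ]) * ψ y)  ∎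

    vanishes : ∀ y → combination x δ y * ψ y ≈ 0#
    vanishes y = cases (y ∈? V)
      where
      cases : Dec (y ∈ V) → combination x δ y * ψ y ≈ 0#
      cases (yes y∈V) = trans (*-congʳ (x∈ y (V⇒Inner y∈V))) (zeroˡ _)
      cases (no y∉V)  = trans (*-congˡ (x≈y⇒x-y≈0 (reflexive (≡.cong φ (collapse-∉ y∉V))))) (zeroʳ _)

  dimension-flow : ∀ {d} → HasBasis (Flow (collapse ∘ src) (collapse ∘ tgt)) d → HasDimension K n (Ω₃ K n G a b) d
  dimension-flow (v , v∈ , indep , span) =
    basis⇒dimension G a b src tgt src-tgt-sound src-tgt-complete src-tgt-injective
    (v , (λ i → flow⇒conserved {v i} (v∈ i)) , indep , λ x x∈ → span x (conserved⇒flow {x} x∈))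

  module _ {t} {Hs : Fin t → Subset n} (components : ListsComponents H Hs) where
    open Components components

    dimension-formula : ∃ λ d → HasDimension K n (Ω₃ K n G a b) d ×
      + d ≡ ((+ length (PartialDigraph.edgeList H) ℤ.- + ∣ V ∣) ℤ.+ + t)
            ℤ.+ + length (E L R)
            ℤ.+ sumℤ (λ k → 0ℤ ℤ.⊔ (+ length (S G a b (Hs k)) ℤ.- 1ℤ))
    dimension-formula with cycle-space (collapse ∘ src) (collapse ∘ tgt)
    ... | d , m , basis , Q , eq = d , dimension-flow basis , formula
      where
      h l σ z : ℕ
      h = length (PartialDigraph.edgeList H)
      l = length (E L R)
      σ = sumℕ λ k → length (Sₖ k)
      z = ∣ free ∣
      M = sumℤ (λ k → 0ℤ ℤ.⊔ (+ length (S G a b (Hs k)) ℤ.- 1ℤ))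

      eqℕ : d ℕ.+ ∣ V ∣ ≡ h ℕ.+ (l ℕ.+ σ) ℕ.+ z
      -- The ground vertex is counted among the vertices and its class among the classes, so one
      -- `suc` cancels on each side.
      eqℕ = ℕ.suc-injective (≡.trans (≡.sym (ℕ.+-suc d ∣ V ∣)) (≡.trans eq (≡.trans
        (≡.cong₂ ℕ._+_ count-middle-edges (coequalizer-unique Q coequalizer)) (ℕ.+-suc _ z))))

      formula : + d ≡ ((+ h ℤ.- + ∣ V ∣) ℤ.+ + t) ℤ.+ + l ℤ.+ M
      formula = ≡R.begin
        + d
          ≡R.≡⟨ solve 2 (λ x y → x := (x :+ y) :- y) ≡.refl (+ d) (+ ∣ V ∣) ⟩
        + (d ℕ.+ ∣ V ∣) ℤ.- + ∣ V ∣
          ≡R.≡⟨ ≡.cong (λ x → + x ℤ.- + ∣ V ∣) eqℕ ⟩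
        + h ℤ.+ (+ l ℤ.+ + σ) ℤ.+ + z ℤ.- + ∣ V ∣
          ≡R.≡⟨ solve 5 (λ h l σ z v → h :+ (l :+ σ) :+ z :- v := (h :- v) :+ l :+ (σ :+ z))
                  ≡.refl (+ h) (+ l) (+ σ) (+ z) (+ ∣ V ∣) ⟩
        (+ h ℤ.- + ∣ V ∣) ℤ.+ + l ℤ.+ (+ σ ℤ.+ + z)
          ≡R.≡⟨ ≡.cong (λ x → (+ h ℤ.- + ∣ V ∣) ℤ.+ + l ℤ.+ x) (sum-predecessors (length ∘ Sₖ)) ⟨
        (+ h ℤ.- + ∣ V ∣) ℤ.+ + l ℤ.+ (M ℤ.+ + t)
          ≡R.≡⟨ solve 4 (λ x l m t → x :+ l :+ (m :+ t) := x :+ t :+ l :+ m)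
                  ≡.refl (+ h ℤ.- + ∣ V ∣) (+ l) M (+ t) ⟩
        ((+ h ℤ.- + ∣ V ∣) ℤ.+ + t) ℤ.+ + l ℤ.+ M
          ≡R.∎
        where
        module ≡R = ≡.≡-Reasoning
        open +-*-Solver

open import Algebra.Apartness.Bundles using (HeytingField)
open import Data.Fin.Base using (Fin)
open import Data.Fin.Subset using (Subset; _∪_; _∩_; _─_; ⁅_⁆; ∣_∣)
open import Data.Integer.Base using (+_; 0ℤ; 1ℤ; _+_; _-_; _⊔_)
open import Data.Integer.Properties using (+-0-commutativeMonoid)
open import Algebra.Properties.CommutativeMonoid.Sum +-0-commutativeMonoid using (sum)
open import Data.List.Base using (length)
open import Data.Nat.Base using (ℕ)
open import Data.Product.Base using (∃; _×_)
open import Relation.Binary.PropositionalEquality.Core using (_≡_)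

theorem4p2 :
  ∀ {c ℓ₁ ℓ₂ ℓ} (K : HeytingField c ℓ₁ ℓ₂) {n : ℕ} (G : Digraph n ℓ) (a b : Fin n) →
  let open Digraph G
      A = A-set G a b
      B = B-set G a b
      H = Ind G (A ─ B) (B ─ A)
      open PartialDigraph H
  in
  (t : ℕ) (Hs : Fin t → Subset n) → ListsComponents H Hs →
  ∃ λ (d : ℕ) → HasDimension K n (Ω₃ K n G a b) d ×
    + d ≡ ((+ length edgeList - + ∣ vertexSet ∣) + + t)
          + + length (E (N⁺ a ∩ (N⁻ b ∪ ⁅ b ⁆)) ((N⁺ a ∪ ⁅ a ⁆) ∩ N⁻ b))
          + sum (λ k → 0ℤ ⊔ (+ length (S G a b (Hs k)) - 1ℤ))
theorem4p2 K G a b t Hs components = dimension-formula K G a b components
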